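{- Every graph that contains a spanning triangle-tree and has at most three vertices of degree $3$ admits a nowhere-zero $3$-flow.
   Context: Graphs are finite, may contain parallel edges, but have no loops. Nowhere-zero $3$-flow: a pair $(D,f)$ where $D$ is an orientation of $G$ and $f:E(G)\to\{\pm1,\pm2\}$ satisfies $\sum_{e\in E_D^+(v)}f(e)=\sum_{e\in E_D^-(v)}f(e)$ for every vertex $v$, where $E_D^+(v)$, $E_D^-(v)$ are the sets of arcs leaving and entering $v$. Triangle-tree: a graph formed by starting with a triangle $x_1x_2x_3$ and then repeatedly (zero or more times) adding a new vertex $x_{j+1}$ joined to exactly two vertices $y,z$ that are adjacent in the graph already constructed (so $x_{j+1},y,z$ form a triangle). A spanning triangle-tree of $G$ is a subgraph of $G$ that is a triangle-tree and contains all vertices of $G$. -}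

module Defs where

open import Data.Fin using (Fin)
open import Data.Fin.Properties using (_≟_)
open import Data.Fin.Subset using (Subset; ⁅_⁆; _∪_; _∈_; _∉_)
open import Data.Integer using (ℤ; +_; -_; _+_; 0ℤ)
open import Data.List using (List; []; _∷_; allFin; filter; foldr; length; map)
import Data.List.Membership.Propositional as List
open import Data.Nat using (ℕ)
import Data.Nat as ℕ
open import Data.Product using (_×_; _,_; proj₁; proj₂; ∃₂)
open import Data.Sum using (_⊎_)
open import Relation.Binary.PropositionalEquality using (_≡_; _≢_)
open import Relation.Nullary using (Dec)
open import Relation.Nullary.Decidable using (_⊎-dec_)

-- Finite loopless multigraphs.  Edges are undirected: the order in which
-- `ends` lists the two endpoints of an edge carries no meaning.
record Graph : Set where
  field
    order    : ℕ
    size     : ℕ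
    ends     : Fin size → Fin order × Fin order
    loopless : ∀ e → proj₁ (ends e) ≢ proj₂ (ends e)

  Vertex : Set
  Vertex = Fin order

  Edge : Set
  Edge = Fin size

  Joins : Edge → Vertex → Vertex → Set
  Joins e u v = ends e ≡ (u , v) ⊎ ends e ≡ (v , u)

  Incident : Vertex → Edge → Set
  Incident v e = proj₁ (ends e) ≡ v ⊎ proj₂ (ends e) ≡ v

  incident? : ∀ v e → Dec (Incident v e)
  incident? v e = (proj₁ (ends e) ≟ v) ⊎-dec (proj₂ (ends e) ≟ v)

  degree : Vertex → ℕ
  degree v = length (filter (incident? v) (allFin size))

  verticesOfDegree : ℕ → List Vertex
  verticesOfDegree d = filter (λ v → degree v ℕ.≟ d) (allFin order)

module _ (G : Graph) where
  open Graph G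

  -- `TriangleTree V E`: the subgraph of G with vertex set V and edge set E is
  -- a triangle-tree.  Exactly one edge is chosen for each adjacency, so the
  -- subgraph is simple even when G has parallel edges.  The vertices x, y, z
  -- of a triangle are automatically distinct, as G is loopless, and the ends
  -- of every edge of E automatically lie in V.
  data TriangleTree : Subset order → Subset size → Set where
    triangle : ∀ {x y z a b c} →
      Joins a x y → Joins b y z → Joins c x z →
      TriangleTree (⁅ x ⁆ ∪ ⁅ y ⁆ ∪ ⁅ z ⁆) (⁅ a ⁆ ∪ ⁅ b ⁆ ∪ ⁅ c ⁆)
    addVertex : ∀ {V E x y z a b c} →
      TriangleTree V E →
      a ∈ E → Joins a y z →
      x ∉ V → Joins b x y → Joins c x z →
      TriangleTree (⁅ x ⁆ ∪ V) (⁅ b ⁆ ∪ ⁅ c ⁆ ∪ E)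

  HasSpanningTriangleTree : Set
  HasSpanningTriangleTree = ∃₂ λ V E → TriangleTree V E × (∀ v → v ∈ V)

  record Orientation : Set where
    field
      tail  : Edge → Vertex
      head  : Edge → Vertex
      joins : ∀ e → Joins e (tail e) (head e)

    arcsOut : Vertex → List Edge
    arcsOut v = filter (λ e → tail e ≟ v) (allFin size)

    arcsIn : Vertex → List Edge
    arcsIn v = filter (λ e → head e ≟ v) (allFin size)

  sumOver : (Edge → ℤ) → List Edge → ℤ
  sumOver f es = foldr _+_ 0ℤ (map f es)

  record NowhereZero3Flow : Set where
    field
      orientation : Orientation
    open Orientation orientation
    field
      flow         : Edge → ℤ
      values       : ∀ e → flow e List.∈ (+ 1 ∷ - (+ 1) ∷ + 2 ∷ - (+ 2) ∷ [])
      conservation : ∀ v → sumOver flow (arcsOut v) ≡ sumOver flow (arcsIn v)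

{-# OPTIONS --safe #-}
module Submission where

-- Fix a triangle-tree T on n vertices, grown from an edge by n − 2 triangles t, and work modulo 3.  T has a
-- proper 3-colouring χ, and the triangles have dual vectors g_t.  By induction on T, a boundary β with Σ β = 0
-- is realised by ±1 on the edges of T as soon as ⟨χ,β⟩ ≠ 0 or some ⟨g_t,β⟩ = 0.  The edges outside T may carry
-- arbitrary signs, so if G has no flow then each of them joins vertices of equal colour, and for every t exactly
-- one of them, e = uv, has g_t(u) − g_t(v) ≠ 0.  These differences are 0 or ±1 over ℤ and are the coefficients of
-- u − v in terms of triangles.  Modulo 2 this makes every degree odd; as each e uses at least two triangles, there
-- are at most (n − 2)/2 edges outside T.  So the degrees are odd, at least 3 and have sum at most 5n − 8, and at
-- least four of them equal 3.  Finally, flows modulo 3 lift to integer flows by Tutte's augmentation argument.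

open import Defs
open import Data.Empty using (⊥-elim)
open import Data.Fin using (Fin)
open import Data.Fin.Properties using (_≟_; any?)
open import Data.Fin.Subset as Subset using (Subset; ⁅_⁆; _∪_)
open import Data.Fin.Subset.Induction using (⊃-wellFounded; Acc; acc)
import Data.Fin.Subset.Properties as Subset
open import Data.Integer using
  (ℤ; +_; -[1+_]; -_; _+_; _-_; _*_; ∣_∣; 0ℤ; 1ℤ; -1ℤ; _≤_; _<_; +≤+; +<+; _<?_; nonNegative)
open import Data.Integer.DivMod using (a≡a%n+[a/n]*n; n%d<d; _/_; _%_)
open import Data.Integer.Divisibility.Signed using
  (_∣_; divides; ∣m∣n⇒∣m+n; ∣m∣n⇒∣m-n; ∣m⇒∣-m; ∣m⇒∣m*n; ∣n⇒∣m*n; _∣?_)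
import Data.Integer.Properties as ℤ
open import Data.Integer.Tactic.RingSolver using (solve-∀)
open import Data.List using (List; []; _∷_; allFin; filter; length; map)
import Data.List.Membership.DecPropositional as DecMembership
open import Data.List.Membership.Propositional using (_∈_; _∉_; lose)
open import Data.List.Membership.Propositional.Properties using (∈-allFin)
open import Data.List.Properties using (length-map)
open import Data.List.Relation.Unary.All as All using (All; []; _∷_)
import Data.List.Relation.Unary.All.Properties as All
open import Data.List.Relation.Unary.Any as Any using (Any; here; there)
import Data.List.Relation.Unary.Any.Properties as Any
open import Data.List.Relation.Unary.Unique.Propositional using (Unique; []; _∷_)
open import Data.List.Relation.Unary.Unique.Propositional.Properties using (allFin⁺)
open import Data.Nat using (ℕ; zero; suc)
import Data.Nat as ℕ
import Data.Nat.Properties as ℕ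
open import Data.Product using (_×_; _,_; proj₁; proj₂; ∃; map₂)
open import Data.Sum using (_⊎_; inj₁; inj₂)
open import Data.Unit using (⊤; tt)
open import Function using (_∘_; case_of_)
open import Relation.Binary.PropositionalEquality
open import Relation.Nullary using (Dec; yes; no; ¬_)
open import Relation.Nullary.Decidable using (_×-dec_; ¬?; from-no; decidable-stable)
open import Relation.Unary using (Decidable)

-- Sums over lists

-- At the vertex x added last, the two new edges must contribute β(x) modulo 3. If β(x) is nonzero,
-- both signs are forced to be -β(x), as -2 ≡ 1, and the same problem is left on the smaller tree.
-- If β(x) is zero, one sign remains to be chosen, and a single such choice suffices. Hence g_t
-- starts as the unit vector at the new vertex of t: ⟨g_t,β⟩ is the residue met there after the
-- forced signs at all later vertices. If no choice ever arises, the forced signs lead down to the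
-- first edge, where ⟨χ,β⟩ tells whether a nonzero value is left for it. "Exactly one" arises
-- because a sum of terms ±q with q in {0, 1, -1} avoids 0 modulo 3 for all signs only if one q is
-- nonzero; two units already attain every residue. The obstacle is to pass from residues modulo 3
-- to parities. The bridge is an identity over ℤ: if u and v have the same colour, then u - v = Σ_t
-- (g_t(u) - g_t(v)) 1_t. Reduced modulo 2 it gives the degrees; summed over coordinates it gives
-- the two triangles per edge. A vertex in τ triangles has degree τ + 1 in T, so 5n - 8 is 3(n - 2)
-- + n + (n - 2).

private variable
  A B : Set
  n : ℕ

∑ : List A → (A → ℤ) → ℤ
∑ []       f = 0ℤ
∑ (x ∷ xs) f = f x + ∑ xs f

addˡ : ∀ a {b c} → b ≡ c → a + b ≡ a + c
addˡ a refl = refl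

infix 5 ∑
syntax ∑ xs (λ x → e) = ∑[ x ← xs ] e

∑-cong : {f g : A → ℤ} (xs : List A) → (∀ {x} → x ∈ xs → f x ≡ g x) → ∑ xs f ≡ ∑ xs g
∑-cong []       eq = refl
∑-cong (x ∷ xs) eq = cong₂ _+_ (eq (here refl)) (∑-cong xs (eq ∘ there))

∑-≗ : {f g : A → ℤ} (xs : List A) → (∀ x → f x ≡ g x) → ∑ xs f ≡ ∑ xs g
∑-≗ xs eq = ∑-cong xs λ {x} _ → eq x

∑-zero : (xs : List A) → ∑[ x ← xs ] 0ℤ ≡ 0ℤ
∑-zero []       = refl
∑-zero (_ ∷ xs) = trans (ℤ.+-identityˡ _) (∑-zero xs)

∑-+ : (xs : List A) (f g : A → ℤ) → ∑[ x ← xs ] (f x + g x) ≡ ∑ xs f + ∑ xs g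
∑-+ []       f g = refl
∑-+ (x ∷ xs) f g = trans (addˡ (f x + g x) (∑-+ xs f g)) (interchange (f x) (g x) (∑ xs f) (∑ xs g))
  where
  interchange : ∀ a b c d → a + b + (c + d) ≡ a + c + (b + d)
  interchange = solve-∀

∑-* : (xs : List A) (k : ℤ) (f : A → ℤ) → ∑[ x ← xs ] (k * f x) ≡ k * ∑ xs f
∑-* []       k f = sym (ℤ.*-zeroʳ k)
∑-* (x ∷ xs) k f = trans (addˡ (k * f x) (∑-* xs k f)) (sym (ℤ.*-distribˡ-+ k (f x) (∑ xs f)))

∑-swap : (xs : List A) (ys : List B) (f : A → B → ℤ) →
         ∑[ x ← xs ] ∑[ y ← ys ] f x y ≡ ∑[ y ← ys ] ∑[ x ← xs ] f x y
∑-swap []       ys f = sym (∑-zero ys)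
∑-swap (x ∷ xs) ys f = trans (addˡ (∑ ys (f x)) (∑-swap xs ys f)) (sym (∑-+ ys (f x) _))

∑-∣ : ∀ {d} (xs : List A) {f : A → ℤ} → (∀ {x} → x ∈ xs → d ∣ f x) → d ∣ ∑ xs f
∑-∣ []       d∣f = divides 0ℤ refl
∑-∣ (x ∷ xs) d∣f = ∣m∣n⇒∣m+n (d∣f (here refl)) (∑-∣ xs (d∣f ∘ there))

∑-≤ : (xs : List A) {f g : A → ℤ} → (∀ {x} → x ∈ xs → f x ≤ g x) → ∑ xs f ≤ ∑ xs g
∑-≤ []       f≤g = ℤ.≤-refl
∑-≤ (x ∷ xs) f≤g = ℤ.+-mono-≤ (f≤g (here refl)) (∑-≤ xs (f≤g ∘ there))

∑-< : (xs : List A) {f g : A → ℤ} {y : A} → (∀ x → f x ≤ g x) → y ∈ xs → f y < g y → ∑ xs f < ∑ xs g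
∑-< (x ∷ xs) f≤g (here refl)  f<g = ℤ.+-mono-<-≤ f<g (∑-≤ xs λ {x} _ → f≤g x)
∑-< (x ∷ xs) f≤g (there y∈xs) f<g = ℤ.+-mono-≤-< (f≤g x) (∑-< xs f≤g y∈xs f<g)

0≤∑ : (xs : List A) {f : A → ℤ} → (∀ {x} → x ∈ xs → 0ℤ ≤ f x) → 0ℤ ≤ ∑ xs f
0≤∑ xs 0≤f = ℤ.≤-trans (ℤ.≤-reflexive (sym (∑-zero xs))) (∑-≤ xs 0≤f)

term≤∑ : {xs : List A} {f : A → ℤ} {y : A} → (∀ x → 0ℤ ≤ f x) → y ∈ xs → f y ≤ ∑ xs f
term≤∑ {xs = x ∷ xs} {f} 0≤f (here refl) =
  ℤ.≤-trans (ℤ.≤-reflexive (sym (ℤ.+-identityʳ _))) (ℤ.+-monoʳ-≤ (f x) (0≤∑ xs λ {x} _ → 0≤f x))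
term≤∑ {xs = x ∷ xs} {f} 0≤f (there y∈xs) =
  ℤ.≤-trans (ℤ.≤-reflexive (sym (ℤ.+-identityˡ _))) (ℤ.+-mono-≤ (0≤f x) (term≤∑ 0≤f y∈xs))

∑-filter : {P : A → Set} (P? : Decidable P) (f : A → ℤ) {g : A → ℤ} →
           (∀ {x} → P x → g x ≡ f x) → (∀ {x} → ¬ P x → g x ≡ 0ℤ) →
           (xs : List A) → ∑ (filter P? xs) f ≡ ∑ xs g
∑-filter P? f g≡f g≡0 []       = refl
∑-filter P? f g≡f g≡0 (x ∷ xs) with P? x
... | yes p = cong₂ _+_ (sym (g≡f p)) (∑-filter P? f g≡f g≡0 xs)
... | no ¬p = trans (∑-filter P? f g≡f g≡0 xs)
                (trans (sym (ℤ.+-identityˡ _)) (cong₂ _+_ (sym (g≡0 ¬p)) refl))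

∑-1 : (xs : List A) → ∑[ x ← xs ] 1ℤ ≡ + length xs
∑-1 []       = refl
∑-1 (x ∷ xs) = cong₂ _+_ (refl {x = 1ℤ}) (∑-1 xs)

-- Kronecker deltas and multiplicities in lists.

δ : Fin n → Fin n → ℤ
δ u v with u ≟ v
... | yes _ = 1ℤ
... | no  _ = 0ℤ

δ-refl : (u : Fin n) → δ u u ≡ 1ℤ
δ-refl u with u ≟ u
... | yes _ = refl
... | no  p = ⊥-elim (p refl)

δ-≢ : {u v : Fin n} → u ≢ v → δ u v ≡ 0ℤ
δ-≢ {u = u} {v} u≢v with u ≟ v
... | yes p = ⊥-elim (u≢v p)
... | no  _ = refl

δ-sym : (u v : Fin n) → δ u v ≡ δ v u
δ-sym u v with u ≟ v
... | yes refl = sym (δ-refl u)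
... | no  u≢v  = sym (δ-≢ (u≢v ∘ sym))

∑-δ-∉ : {u : Fin n} (xs : List (Fin n)) (f : Fin n → ℤ) → u ∉ xs → ∑[ x ← xs ] (δ u x * f x) ≡ 0ℤ
∑-δ-∉ []       f u∉xs = refl
∑-δ-∉ (x ∷ xs) f u∉xs =
  cong₂ _+_ (cong (_* f x) (δ-≢ (u∉xs ∘ here))) (∑-δ-∉ xs f (u∉xs ∘ there))

∑-δ-∈ : {u : Fin n} {xs : List (Fin n)} (f : Fin n → ℤ) → Unique xs → u ∈ xs →
        ∑[ x ← xs ] (δ u x * f x) ≡ f u
∑-δ-∈ {u = u} {x ∷ xs} f (x∉xs ∷ _) (here refl) =
  trans (cong₂ _+_ (trans (cong (_* f x) (δ-refl x)) (ℤ.*-identityˡ _)) (∑-δ-∉ xs f (All.All¬⇒¬Any x∉xs)))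
        (ℤ.+-identityʳ _)
∑-δ-∈ {u = u} {x ∷ xs} f (x∉xs ∷ uniq) (there u∈xs) =
  trans (cong₂ _+_ (cong (_* f x) (δ-≢ {u = u} {x} λ { refl → All.All¬⇒¬Any x∉xs u∈xs })) (∑-δ-∈ f uniq u∈xs))
        (ℤ.+-identityˡ _)

∑-δ : (u : Fin n) (f : Fin n → ℤ) → ∑[ x ← allFin n ] (δ u x * f x) ≡ f u
∑-δ u f = ∑-δ-∈ f (allFin⁺ _) (∈-allFin u)

count : List (Fin n) → Fin n → ℤ
count xs v = ∑[ x ← xs ] δ x v

count-∈ : {xs : List (Fin n)} {v : Fin n} → Unique xs → v ∈ xs → count xs v ≡ 1ℤ
count-∈ {xs = xs} {v} uniq v∈xs =
  trans (∑-≗ xs λ x → trans (δ-sym x v) (sym (ℤ.*-identityʳ _))) (∑-δ-∈ (λ _ → 1ℤ) uniq v∈xs)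

count-∉ : {xs : List (Fin n)} {v : Fin n} → v ∉ xs → count xs v ≡ 0ℤ
count-∉ {xs = xs} {v} v∉xs =
  trans (∑-≗ xs λ x → trans (δ-sym x v) (sym (ℤ.*-identityʳ _))) (∑-δ-∉ xs (λ _ → 1ℤ) v∉xs)

∑-count : (xs : List (Fin n)) (f : Fin n → ℤ) → ∑[ v ← allFin n ] (count xs v * f v) ≡ ∑ xs f
∑-count {n} []       f = ∑-zero (allFin n)
∑-count {n} (x ∷ xs) f = begin
  ∑[ v ← allFin n ] ((δ x v + count xs v) * f v)
    ≡⟨ ∑-≗ (allFin n) (λ v → ℤ.*-distribʳ-+ (f v) (δ x v) (count xs v)) ⟩
  ∑[ v ← allFin n ] (δ x v * f v + count xs v * f v)
    ≡⟨ ∑-+ (allFin n) _ _ ⟩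
  (∑[ v ← allFin n ] (δ x v * f v)) + (∑[ v ← allFin n ] (count xs v * f v))
    ≡⟨ cong₂ _+_ (∑-δ x f) (∑-count xs f) ⟩
  f x + ∑ xs f ∎
  where open ≡-Reasoning

∑-map : ∀ {A B : Set} (h : A → B) (xs : List A) (f : B → ℤ) → ∑ (map h xs) f ≡ ∑[ x ← xs ] f (h x)
∑-map h []       f = refl
∑-map h (x ∷ xs) f = addˡ (f (h x)) (∑-map h xs f)

∣-resp : ∀ {d x y} → d ∣ x - y → d ∣ y → d ∣ x
∣-resp {d} {x} {y} d∣x-y d∣y = subst (d ∣_) (cancel x y) (∣m∣n⇒∣m+n d∣x-y d∣y)
  where
  cancel : ∀ x y → x - y + y ≡ x
  cancel = solve-∀

∣-neg : ∀ {d x y} → d ∣ x - y → d ∣ y - x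
∣-neg {d} {x} {y} d∣x-y = subst (d ∣_) (swap x y) (∣m⇒∣-m d∣x-y)
  where
  swap : ∀ x y → - (x - y) ≡ y - x
  swap = solve-∀

-- Residues modulo 3, signs and admissible flow values.

data Unit : ℤ → Set where
  +1u : Unit 1ℤ
  -1u : Unit -1ℤ

shift3 : ∀ m d → m * + 3 * d ≡ m * d * + 3
shift3 = solve-∀

neg-unit : ∀ {u} → Unit u → Unit (- u)
neg-unit +1u = -1u
neg-unit -1u = +1u

unit-∤ : ∀ {u} → Unit u → ¬ + 3 ∣ u
unit-∤ +1u = from-no (+ 3 ∣? 1ℤ)
unit-∤ -1u = from-no (+ 3 ∣? -1ℤ)

unit-or-zero : ∀ m → (∃ λ u → Unit u × + 3 ∣ m - u) ⊎ + 3 ∣ m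
unit-or-zero m with m % + 3 | a≡a%n+[a/n]*n m (+ 3) | n%d<d m (+ 3)
... | 0 | m≡ | _ = inj₂ (divides (m / + 3) (trans m≡ (ℤ.+-identityˡ (m / + 3 * + 3))))
... | 1 | m≡ | _ = inj₁ (1ℤ , +1u , divides (m / + 3) (trans (cong (_- 1ℤ) m≡) (rearrange (m / + 3))))
  where
  rearrange : ∀ q → 1ℤ + q * + 3 - 1ℤ ≡ q * + 3
  rearrange = solve-∀
... | 2 | m≡ | _ = inj₁ (-1ℤ , -1u , divides (m / + 3 + 1ℤ) (trans (cong (_- -1ℤ) m≡) (rearrange (m / + 3))))
  where
  rearrange : ∀ q → + 2 + q * + 3 - -1ℤ ≡ (q + 1ℤ) * + 3
  rearrange = solve-∀
... | suc (suc (suc r)) | _ | ℕ.s≤s (ℕ.s≤s (ℕ.s≤s ()))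

-- As 2 ≡ -1, a nonzero residue r is -r taken twice, and 0 is 1 + -1.
two-units : ∀ m → ∃ λ u → ∃ λ w → Unit u × Unit w × + 3 ∣ m - (u + w)
two-units m with unit-or-zero m
... | inj₁ (_ , +1u , d) = -1ℤ , -1ℤ , -1u , -1u , subst (+ 3 ∣_) (rearrange m) (∣m∣n⇒∣m+n d (divides 1ℤ refl))
  where
  rearrange : ∀ m → m - 1ℤ + + 3 ≡ m - (-1ℤ + -1ℤ)
  rearrange = solve-∀
... | inj₁ (_ , -1u , d) = 1ℤ , 1ℤ , +1u , +1u , subst (+ 3 ∣_) (rearrange m) (∣m∣n⇒∣m+n d (divides -1ℤ refl))
  where
  rearrange : ∀ m → m - -1ℤ + - (+ 3) ≡ m - (1ℤ + 1ℤ)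
  rearrange = solve-∀
... | inj₂ d = 1ℤ , -1ℤ , +1u , -1u , subst (+ 3 ∣_) (sym (ℤ.+-identityʳ m)) d

data Value : ℤ → Set where
  +1v : Value (+ 1)
  -1v : Value (- (+ 1))
  +2v : Value (+ 2)
  -2v : Value (- (+ 2))

-- Subtracting 3 keeps a positive value admissible and reverses its sign. The factor `1ℤ` is what
-- `δ e e′` reduces to at the modified edge.
lower : ∀ {x} → Value x → 0ℤ < x → Value (x + - (+ 3) * 1ℤ)
lower +1v _ = -2v
lower +2v _ = -1v
lower -1v ()
lower -2v ()

raise : ∀ {x} → Value x → x < 0ℤ → Value (x + + 3 * 1ℤ)
raise -1v _ = +2v
raise -2v _ = +1v
raise +1v (+<+ ())
raise +2v (+<+ ())

value∈ : ∀ {x} → Value x → x ∈ (+ 1 ∷ - (+ 1) ∷ + 2 ∷ - (+ 2) ∷ [])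
value∈ +1v = here refl
value∈ -1v = there (here refl)
value∈ +2v = there (there (here refl))
value∈ -2v = there (there (there (here refl)))

-- A positive multiple of 3 is at least 3, so the step cannot overshoot 0. The difference `0ℤ - 1ℤ`
-- is the value of `δ w v - δ u v` at `v = u`.
shrink⁺ : ∀ {x} → + 3 ∣ x → 0ℤ < x → + ∣ x + + 3 * (0ℤ - 1ℤ) ∣ < + ∣ x ∣
shrink⁺ (divides (+ suc q) refl) _ = +<+ (ℕ.m<n+m (q ℕ.* 3) {3} (ℕ.s≤s ℕ.z≤n))
shrink⁺ (divides (+ zero) refl) (+<+ ())
shrink⁺ (divides -[1+ q ] refl) ()

shrink⁻ : ∀ {x} → + 3 ∣ x → x < 0ℤ → + ∣ x + + 3 * (1ℤ - 0ℤ) ∣ < + ∣ x ∣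
shrink⁻ {x} 3∣x x<0 = subst₂ _<_
  (trans (cong (λ y → + ∣ y ∣) (rearrange x)) (cong +_ (ℤ.∣-i∣≡∣i∣ (x + + 3 * (1ℤ - 0ℤ)))))
                        (cong +_ (ℤ.∣-i∣≡∣i∣ x)) (shrink⁺ (∣m⇒∣-m 3∣x) (ℤ.neg-mono-< x<0))
  where
  rearrange : ∀ x → - x + + 3 * (0ℤ - 1ℤ) ≡ - (x + + 3 * (1ℤ - 0ℤ))
  rearrange = solve-∀

-- Arithmetic modulo 3

data Trit : ℤ → Set where
  t+ : Trit 1ℤ
  t0 : Trit 0ℤ
  t- : Trit -1ℤ

data Adjacent : ℤ → ℤ → Set where
  pz : Adjacent 1ℤ 0ℤ
  zp : Adjacent 0ℤ 1ℤ
  pm : Adjacent 1ℤ -1ℤ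
  mp : Adjacent -1ℤ 1ℤ
  zm : Adjacent 0ℤ -1ℤ
  mz : Adjacent -1ℤ 0ℤ

-- It has two roles: on the colours 1, 0, -1 it yields the remaining colour, and on arbitrary values
-- it completes a triangle to sum 0.
third : ℤ → ℤ → ℤ
third i j = - (i + j)

third-comm : ∀ i j → third i j ≡ third j i
third-comm i j = cong -_ (ℤ.+-comm i j)

third-third : ∀ i j → third (third i j) i ≡ j
third-third = identity
  where
  identity : ∀ i j → - (- (i + j) + i) ≡ j
  identity = solve-∀

adjacent-sym : ∀ {i j} → Adjacent i j → Adjacent j i
adjacent-sym pz = zp
adjacent-sym zp = pz
adjacent-sym pm = mp
adjacent-sym mp = pm
adjacent-sym zm = mz
adjacent-sym mz = zm

adjacent-third : ∀ {i j} → Adjacent i j → Adjacent (third i j) i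
adjacent-third pz = mp
adjacent-third zp = mz
adjacent-third pm = zp
adjacent-third mp = zm
adjacent-third zm = pz
adjacent-third mz = pm

adjacent-≢ : ∀ {i j} → Adjacent i j → i ≢ j
adjacent-≢ pz ()
adjacent-≢ zp ()
adjacent-≢ pm ()
adjacent-≢ mp ()
adjacent-≢ zm ()
adjacent-≢ mz ()

adjacent-trit : ∀ {i j} → Adjacent i j → Trit i
adjacent-trit pz = t+
adjacent-trit zp = t0
adjacent-trit pm = t+
adjacent-trit mp = t-
adjacent-trit zm = t0
adjacent-trit mz = t-

_∈₀_ : ℤ → ℤ → Set
x ∈₀ s = x ≡ 0ℤ ⊎ x ≡ s

-- Values of signed sums modulo 3

-- The constructors stand for zero, one and at least two nonzero coefficients. In `single`,
-- attaining both units is what the passage to a second nonzero coefficient uses.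
data Signing (A : Set) (xs : List A) (q : A → ℤ) : Set where
  vanishing : (∀ {x} → x ∈ xs → q x ≡ 0ℤ) → Signing A xs q
  single    : ∑[ x ← xs ] (q x * q x) ≡ 1ℤ →
              (∀ {r} → Unit r → ∃ λ (ε : A → ℤ) → (∀ x → Unit (ε x)) × ∑[ x ← xs ] (q x * ε x) ≡ r) → Signing A xs q
  universal : (∀ r → ∃ λ (ε : A → ℤ) → (∀ x → Unit (ε x)) × + 3 ∣ r - (∑[ x ← xs ] (q x * ε x))) → Signing A xs q

unit² : ∀ {u} → Unit u → u * u ≡ 1ℤ
unit² +1u = refl
unit² -1u = refl

unit-* : ∀ {u w} → Unit u → Unit w → Unit (u * w)
unit-* +1u +1u = +1u
unit-* +1u -1u = -1u
unit-* -1u +1u = -1u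
unit-* -1u -1u = +1u

trit-cases : ∀ {q} → Trit q → q ≡ 0ℤ ⊎ Unit q
trit-cases t+ = inj₂ +1u
trit-cases t0 = inj₁ refl
trit-cases t- = inj₂ -1u

module _ {n : ℕ} where
  override : Fin n → ℤ → (Fin n → ℤ) → Fin n → ℤ
  override x k ε y with x ≟ y
  ... | yes _ = k
  ... | no  _ = ε y

  override-at : ∀ x k ε → override x k ε x ≡ k
  override-at x k ε with x ≟ x
  ... | yes _ = refl
  ... | no  p = ⊥-elim (p refl)

  override-off : ∀ {x y} k ε → x ≢ y → override x k ε y ≡ ε y
  override-off {x} {y} k ε x≢y with x ≟ y
  ... | yes p = ⊥-elim (x≢y p)
  ... | no  _ = refl

  override-units : ∀ x {k ε} → Unit k → (∀ y → Unit (ε y)) → ∀ y → Unit (override x k ε y)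
  override-units x unit units y with x ≟ y
  ... | yes _ = unit
  ... | no  _ = units y

  override-∑ : ∀ {x xs} k ε (q : Fin n → ℤ) → x ∉ xs →
               ∑[ y ← x ∷ xs ] (q y * override x k ε y) ≡ q x * k + (∑[ y ← xs ] (q y * ε y))
  override-∑ {x} {xs} k ε q x∉xs =
    cong₂ _+_ (cong (q x *_) (override-at x k ε))
              (∑-cong xs λ {y} y∈xs → cong (q y *_) (override-off {x} {y} k ε λ { refl → x∉xs y∈xs }))

  signing : (xs : List (Fin n)) → Unique xs → (q : Fin n → ℤ) → (∀ x → Trit (q x)) → Signing (Fin n) xs q
  signing []       _               q trit = vanishing λ ()
  signing (x ∷ xs) (x∉all ∷ uniq) q trit with trit-cases (trit x) | signing xs uniq q trit
  ... | inj₁ q≡0 | vanishing zeros = vanishing λ { (here refl) → q≡0 ; (there y∈xs) → zeros y∈xs }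
  ... | inj₁ q≡0 | single sq hits = single
        (trans (cong (λ i → i * i + ∑ xs (λ y → q y * q y)) q≡0) (trans (ℤ.+-identityˡ _) sq))
        λ unit → let ε , units , eq = hits unit in
          ε , units , trans (cong (λ i → i * ε x + (∑[ y ← xs ] (q y * ε y))) q≡0) (trans (ℤ.+-identityˡ _) eq)
  ... | inj₁ q≡0 | universal hits = universal λ r → let ε , units , d = hits r in
        ε , units , subst (λ s → + 3 ∣ r - s)
          (sym (trans (cong (λ i → i * ε x + (∑[ y ← xs ] (q y * ε y))) q≡0) (ℤ.+-identityˡ _))) d
  ... | inj₂ unit-q | vanishing zeros = single
        (trans (cong₂ _+_ (unit² unit-q) (trans (∑-cong xs λ y∈xs → cong (λ i → i * i) (zeros y∈xs)) (∑-zero xs)))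
               (ℤ.+-identityʳ 1ℤ))
        λ {r} unit-r → (λ _ → q x * r) , (λ _ → unit-* unit-q unit-r) ,
          trans (cong₂ _+_ (trans (sym (ℤ.*-assoc (q x) (q x) r))
                                  (trans (cong (_* r) (unit² unit-q)) (ℤ.*-identityˡ r)))
                  (trans (∑-cong xs λ y∈xs → cong (_* (q x * r)) (zeros y∈xs)) (∑-zero xs))) (ℤ.+-identityʳ r)
  -- With `r` split into two units, the sign `q x * u` at `x` contributes `q x * q x * u = u`, and
  -- the other nonzero coefficient supplies `w`.
  ... | inj₂ unit-q | single _ hits = universal λ r →
        let u , w , unit-u , unit-w , d = two-units r
            ε , units , eq = hits unit-w
        in override x (q x * u) ε , override-units x (unit-* unit-q unit-u) units ,
           subst (λ s → + 3 ∣ r - s)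
             (sym (trans (override-∑ (q x * u) ε q (All.All¬⇒¬Any x∉all))
               (cong₂ _+_ (trans (sym (ℤ.*-assoc (q x) (q x) u))
                                 (trans (cong (_* u) (unit² unit-q)) (ℤ.*-identityˡ u))) eq))) d
  -- Any sign will do at `x`; with 1 chosen, the tail is asked for the residue that is then missing.
  ... | inj₂ unit-q | universal hits = universal λ r →
        let ε , units , d = hits (r - q x * 1ℤ) in
        override x 1ℤ ε , override-units x +1u units ,
        subst (+ 3 ∣_) (trans (rearrange r (q x * 1ℤ) (∑[ y ← xs ] (q y * ε y)))
          (cong (λ s → r - s) (sym (override-∑ 1ℤ ε q (All.All¬⇒¬Any x∉all))))) d
        where
        rearrange : ∀ r a s → r - a - s ≡ r - (a + s)
        rearrange = solve-∀

∤-doubled-difference : ∀ {i j} → Trit i → Trit j → i ≢ j → ¬ + 3 ∣ - (+ 2) * (i - j)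
∤-doubled-difference t+ t+ i≢j = ⊥-elim (i≢j refl)
∤-doubled-difference t+ t0 _ = from-no (+ 3 ∣? - (+ 2))
∤-doubled-difference t+ t- _ = from-no (+ 3 ∣? - (+ 4))
∤-doubled-difference t0 t+ _ = from-no (+ 3 ∣? + 2)
∤-doubled-difference t0 t0 i≢j = ⊥-elim (i≢j refl)
∤-doubled-difference t0 t- _ = from-no (+ 3 ∣? - (+ 2))
∤-doubled-difference t- t+ _ = from-no (+ 3 ∣? + 4)
∤-doubled-difference t- t0 _ = from-no (+ 3 ∣? + 2)
∤-doubled-difference t- t- i≢j = ⊥-elim (i≢j refl)

trit-even : ∀ {x} → Trit x → + 2 ∣ x * x - x
trit-even t+ = divides 0ℤ refl
trit-even t0 = divides 0ℤ refl
trit-even t- = divides 1ℤ refl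

0≤square : ∀ x → 0ℤ ≤ x * x
0≤square (+ n)    = subst (0ℤ ≤_) (ℤ.pos-* n n) (+≤+ ℕ.z≤n)
0≤square -[1+ n ] = +≤+ ℕ.z≤n

even-positive : ∀ {x} → 0ℤ ≤ x → + 2 ∣ x → x ≢ 0ℤ → + 2 ≤ x
even-positive {+ 0}           _  _   x≢0 = ⊥-elim (x≢0 refl)
even-positive {+ 1}           _  2∣1 _   = ⊥-elim (from-no (+ 2 ∣? + 1) 2∣1)
even-positive {+ suc (suc n)} _  _   _   = +≤+ (ℕ.s≤s (ℕ.s≤s ℕ.z≤n))
even-positive { -[1+ n ]}     () _   _

odd≥5 : ∀ d → + 2 ≤ + d → + 2 ∣ + d - 1ℤ → d ≢ 3 → + 5 ≤ + d
odd≥5 0 (+≤+ ()) _ _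
odd≥5 1 (+≤+ (ℕ.s≤s ())) _ _
odd≥5 2 _ 2∣ _ = ⊥-elim (from-no (+ 2 ∣? + 1) 2∣)
odd≥5 3 _ _ d≢3 = ⊥-elim (d≢3 refl)
odd≥5 4 _ 2∣ _ = ⊥-elim (from-no (+ 2 ∣? + 3) 2∣)
odd≥5 (suc (suc (suc (suc (suc d))))) _ _ _ =
  +≤+ (ℕ.s≤s (ℕ.s≤s (ℕ.s≤s (ℕ.s≤s (ℕ.s≤s ℕ.z≤n)))))

either-all : ∀ {A : Set} {P : A → Set} {F : Set} (xs : List A) → (∀ {x} → x ∈ xs → F ⊎ P x) → F ⊎ All P xs
either-all []       f = inj₂ []
either-all (x ∷ xs) f with f (here refl) | either-all xs (f ∘ there)
... | inj₁ flow | _         = inj₁ flow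
... | inj₂ _    | inj₁ flow = inj₁ flow
... | inj₂ p    | inj₂ ps   = inj₂ (p ∷ ps)

-- Flows and triangle-trees

module OnGraph (G : Graph) where
  open Graph G

  -- Boundaries of edge functions and their pairing with vertex functions.

  vertices : List Vertex
  vertices = allFin order

  edges : List Edge
  edges = allFin size

  tail head : Edge → Vertex
  tail e = proj₁ (ends e)
  head e = proj₂ (ends e)

  inc : Edge → Vertex → ℤ
  inc e v = δ (tail e) v - δ (head e) v

  ∂ : (Edge → ℤ) → Vertex → ℤ
  ∂ F v = ∑[ e ← edges ] (F e * inc e v)

  ⟨_,_⟩ : (Vertex → ℤ) → (Vertex → ℤ) → ℤ
  ⟨ g , β ⟩ = ∑[ v ← vertices ] (g v * β v)

  slope : (Vertex → ℤ) → Edge → ℤ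
  slope g e = g (tail e) - g (head e)

  ⟨⟩-δ : ∀ g u → ⟨ g , δ u ⟩ ≡ g u
  ⟨⟩-δ g u = trans (∑-≗ vertices λ v → ℤ.*-comm (g v) (δ u v)) (∑-δ u g)

  ⟨⟩-+ : ∀ g β γ → ⟨ g , (λ v → β v + γ v) ⟩ ≡ ⟨ g , β ⟩ + ⟨ g , γ ⟩
  ⟨⟩-+ g β γ = trans (∑-≗ vertices λ v → ℤ.*-distribˡ-+ (g v) (β v) (γ v)) (∑-+ vertices _ _)

  ⟨⟩-* : ∀ g k β → ⟨ g , (λ v → k * β v) ⟩ ≡ k * ⟨ g , β ⟩
  ⟨⟩-* g k β = trans (∑-≗ vertices λ v → rearrange (g v) k (β v)) (∑-* vertices k _)
    where
    rearrange : ∀ a b c → a * (b * c) ≡ b * (a * c)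
    rearrange = solve-∀

  ⟨⟩-cong : ∀ g {β γ} → (∀ v → β v ≡ γ v) → ⟨ g , β ⟩ ≡ ⟨ g , γ ⟩
  ⟨⟩-cong g β≗γ = ∑-≗ vertices λ v → cong (g v *_) (β≗γ v)

  ⟨⟩-inc : ∀ g e → ⟨ g , inc e ⟩ ≡ slope g e
  ⟨⟩-inc g e = begin
    ⟨ g , (λ v → δ (tail e) v - δ (head e) v) ⟩
      ≡⟨ ⟨⟩-cong g (λ v → addˡ (δ (tail e) v) (sym (ℤ.-1*i≡-i (δ (head e) v)))) ⟩
    ⟨ g , (λ v → δ (tail e) v + -1ℤ * δ (head e) v) ⟩
      ≡⟨ trans (⟨⟩-+ g (δ (tail e)) _) (cong₂ _+_ (⟨⟩-δ g (tail e)) (⟨⟩-* g -1ℤ (δ (head e)))) ⟩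
    g (tail e) + -1ℤ * ⟨ g , δ (head e) ⟩
      ≡⟨ addˡ (g (tail e)) (trans (ℤ.-1*i≡-i _) (cong -_ (⟨⟩-δ g (head e)))) ⟩
    slope g e ∎
    where open ≡-Reasoning

  ⟨⟩-∂ : ∀ g F → ⟨ g , ∂ F ⟩ ≡ ∑[ e ← edges ] (F e * slope g e)
  ⟨⟩-∂ g F = begin
    ∑[ v ← vertices ] (g v * ∂ F v)
      ≡⟨ ∑-≗ vertices (λ v → sym (∑-* edges (g v) _)) ⟩
    ∑[ v ← vertices ] ∑[ e ← edges ] (g v * (F e * inc e v))
      ≡⟨ ∑-swap vertices edges _ ⟩
    ∑[ e ← edges ] ⟨ g , (λ v → F e * inc e v) ⟩
      ≡⟨ ∑-≗ edges (λ e → trans (⟨⟩-* g (F e) (inc e)) (cong (F e *_) (⟨⟩-inc g e))) ⟩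
    ∑[ e ← edges ] (F e * slope g e) ∎
    where open ≡-Reasoning

  ∂-+δ : ∀ F e k v → ∂ (λ e′ → F e′ + k * δ e e′) v ≡ ∂ F v + k * inc e v
  ∂-+δ F e k v = begin
    ∑[ e′ ← edges ] ((F e′ + k * δ e e′) * inc e′ v)
      ≡⟨ ∑-≗ edges (λ e′ → rearrange (F e′) k (δ e e′) (inc e′ v)) ⟩
    ∑[ e′ ← edges ] (F e′ * inc e′ v + k * (δ e e′ * inc e′ v))
      ≡⟨ ∑-+ edges _ _ ⟩
    ∂ F v + (∑[ e′ ← edges ] (k * (δ e e′ * inc e′ v)))
      ≡⟨ addˡ (∂ F v) (trans (∑-* edges k _) (cong (k *_) (∑-δ e (λ e′ → inc e′ v)))) ⟩
    ∂ F v + k * inc e v ∎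
    where
    open ≡-Reasoning
    rearrange : ∀ a b c d → (a + b * c) * d ≡ a * d + b * (c * d)
    rearrange = solve-∀

  Values : (Edge → ℤ) → Set
  Values F = ∀ e → Value (F e)

  -- Tutte's augmentation: flows modulo 3 lifted to integer flows.

  module Push (F : Edge → ℤ) (values : Values F) (u : Vertex) where

    -- Since F is kept on the edges leaving S, reachable sets can grow without keeping track of simple paths.
    record Transfer (S : Subset order) (w : Vertex) : Set where
      field
        F′      : Edge → ℤ
        values′ : Values F′
        ∂F′     : ∀ v → ∂ F′ v ≡ ∂ F v + + 3 * (δ w v - δ u v)
        same    : ∀ e → tail e Subset.∉ S ⊎ head e Subset.∉ S → F′ e ≡ F e

    -- A transfer inside `S` keeps the original value on `e`, which leaves `S`. So after moving 3
    -- units to the end `v` of `e` in `S`, changing `e` by `k` moves them on to `w`; the changed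
    -- edge then lies inside the larger set and respects `same`.
    extend : ∀ {S v w} e k → v Subset.∈ S → tail e Subset.∉ S ⊎ head e Subset.∉ S →
             (tail e ≡ w × head e Subset.∈ S) ⊎ (head e ≡ w × tail e Subset.∈ S) →
             Value (F e + k * 1ℤ) → (∀ x → k * inc e x ≡ + 3 * (δ w x - δ v x)) →
             (∀ {w} → w Subset.∈ S → Transfer S w) →
             ∀ {w′} → w′ Subset.∈ ⁅ w ⁆ ∪ S → Transfer (⁅ w ⁆ ∪ S) w′
    extend {S} {v} {w} e k v∈S crosses at-w val k*inc transfer {w′} w′∈ with Subset.x∈p∪q⁻ ⁅ w ⁆ S w′∈
    ... | inj₂ w′∈S = record
      { F′ = F′; values′ = values′; ∂F′ = ∂F′
      ; same = λ { e′ (inj₁ t∉) → same e′ (inj₁ (t∉ ∘ Subset.x∈p∪q⁺ ∘ inj₂))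
                 ; e′ (inj₂ h∉) → same e′ (inj₂ (h∉ ∘ Subset.x∈p∪q⁺ ∘ inj₂)) } }
      where open Transfer (transfer w′∈S)
    ... | inj₁ w′∈w rewrite Subset.x∈⁅y⁆⇒x≡y w w′∈w = record
      { F′      = λ e′ → F′ e′ + k * δ e e′
      ; values′ = values″
      ; ∂F′     = λ x → trans (∂-+δ F′ e k x)
                    (trans (cong₂ _+_ (∂F′ x) (k*inc x)) (rearrange (∂ F x) (δ v x) (δ u x) (δ w x)))
      ; same    = λ e′ out → trans (cong₂ _+_ (same e′ (widen out))
                      (trans (cong (k *_) (δ-≢ {u = e} {e′} λ { refl → inside at-w out })) (ℤ.*-zeroʳ k)))
                    (ℤ.+-identityʳ _)
      }
      where
      open Transfer (transfer v∈S)
      rearrange : ∀ f v u w → f + + 3 * (v - u) + + 3 * (w - v) ≡ f + + 3 * (w - u)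
      rearrange = solve-∀
      widen : ∀ {e′} → tail e′ Subset.∉ ⁅ w ⁆ ∪ S ⊎ head e′ Subset.∉ ⁅ w ⁆ ∪ S → tail e′ Subset.∉ S ⊎ head e′ Subset.∉ S
      widen (inj₁ t∉) = inj₁ (t∉ ∘ Subset.x∈p∪q⁺ ∘ inj₂)
      widen (inj₂ h∉) = inj₂ (h∉ ∘ Subset.x∈p∪q⁺ ∘ inj₂)
      inside : (tail e ≡ w × head e Subset.∈ S) ⊎ (head e ≡ w × tail e Subset.∈ S) →
               ¬ (tail e Subset.∉ ⁅ w ⁆ ∪ S ⊎ head e Subset.∉ ⁅ w ⁆ ∪ S)
      inside (inj₁ (refl , _)) (inj₁ t∉) = t∉ (Subset.x∈p∪q⁺ (inj₁ (Subset.x∈⁅x⁆ w)))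
      inside (inj₁ (_ , h∈))   (inj₂ h∉) = h∉ (Subset.x∈p∪q⁺ (inj₂ h∈))
      inside (inj₂ (_ , t∈))   (inj₁ t∉) = t∉ (Subset.x∈p∪q⁺ (inj₂ t∈))
      inside (inj₂ (refl , _)) (inj₂ h∉) = h∉ (Subset.x∈p∪q⁺ (inj₁ (Subset.x∈⁅x⁆ w)))
      values″ : Values (λ e′ → F′ e′ + k * δ e e′)
      values″ e′ with e ≟ e′
      ... | yes refl = subst (λ x → Value (x + k * 1ℤ)) (sym (same e crosses)) val
      ... | no  _    = subst Value (sym (trans (addˡ (F′ e′) (ℤ.*-zeroʳ k)) (ℤ.+-identityʳ _))) (values′ e′)

    ι : Subset order → Vertex → ℤ
    ι S v with v Subset.∈? S
    ... | yes _ = 1ℤ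
    ... | no  _ = 0ℤ

    -- The pairing with the indicator of `S` is the net outflow of `S`: edges within `S` cancel, and
    -- every crossing edge contributes at most 0.
    closed-nonpositive : (S : Subset order) →
      (∀ e → tail e Subset.∈ S → head e Subset.∉ S → F e ≤ 0ℤ) →
      (∀ e → head e Subset.∈ S → tail e Subset.∉ S → 0ℤ ≤ F e) →
      ⟨ ι S , ∂ F ⟩ ≤ 0ℤ
    closed-nonpositive S out-≤ in-≥ =
      ℤ.≤-trans (ℤ.≤-reflexive (⟨⟩-∂ (ι S) F))
        (ℤ.≤-trans (∑-≤ edges λ {e} _ → term≤0 e) (ℤ.≤-reflexive (∑-zero edges)))
      where
      term≤0 : ∀ e → F e * slope (ι S) e ≤ 0ℤ
      term≤0 e with tail e Subset.∈? S | head e Subset.∈? S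
      ... | yes t∈ | yes h∈ = ℤ.≤-reflexive (ℤ.*-zeroʳ (F e))
      ... | yes t∈ | no  h∉ = ℤ.≤-trans (ℤ.≤-reflexive (ℤ.*-identityʳ (F e))) (out-≤ e t∈ h∉)
      ... | no  t∉ | yes h∈ = ℤ.≤-trans (ℤ.≤-reflexive (trans (ℤ.*-comm (F e) -1ℤ) (ℤ.-1*i≡-i (F e))))
                                        (ℤ.neg-mono-≤ (in-≥ e h∈ t∉))
      ... | no  t∉ | no  h∉ = ℤ.≤-reflexive (ℤ.*-zeroʳ (F e))

    nonneg-positive : (S : Subset order) → u Subset.∈ S → 0ℤ < ∂ F u →
      (∀ v → v Subset.∈ S → 0ℤ ≤ ∂ F v) → 0ℤ < ⟨ ι S , ∂ F ⟩
    nonneg-positive S u∈S 0<u 0≤ = ℤ.<-≤-trans 0<term (term≤∑ {y = u} 0≤term (∈-allFin u))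
      where
      0≤term : ∀ v → 0ℤ ≤ ι S v * ∂ F v
      0≤term v with v Subset.∈? S
      ... | yes v∈S = ℤ.≤-trans (0≤ v v∈S) (ℤ.≤-reflexive (sym (ℤ.*-identityˡ _)))
      ... | no  _   = ℤ.≤-refl
      0<term : 0ℤ < ι S u * ∂ F u
      0<term with u Subset.∈? S
      ... | yes _   = ℤ.<-≤-trans 0<u (ℤ.≤-reflexive (sym (ℤ.*-identityˡ _)))
      ... | no  u∉S = ⊥-elim (u∉S u∈S)

    -- The set grows along positive edges leaving it and negative edges entering it. Were it to get
    -- stuck without meeting a negative vertex, its net outflow would be at most 0 by
    -- `closed-nonpositive` and positive because of `u`.
    search : ∀ S → Acc Subset._⊃_ S → u Subset.∈ S → 0ℤ < ∂ F u → (∀ {w} → w Subset.∈ S → Transfer S w) →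
             ∃ λ w → ∂ F w < 0ℤ × ∃ λ S → Transfer S w
    search S (acc rec) u∈S 0<u transfer
      with any? (λ w → (w Subset.∈? S) ×-dec (∂ F w <? 0ℤ))
    ... | yes (w , w∈S , w<0) = w , w<0 , S , transfer w∈S
    ... | no none
      with any? (λ e → (tail e Subset.∈? S) ×-dec (¬? (head e Subset.∈? S)) ×-dec (0ℤ <? F e))
    ... | yes (e , t∈ , h∉ , 0<F) =
      search (⁅ head e ⁆ ∪ S) (rec (Subset.x∈p∪q⁺ ∘ inj₂ , head e , Subset.x∈p∪q⁺ (inj₁ (Subset.x∈⁅x⁆ _)) , h∉))
        (Subset.x∈p∪q⁺ (inj₂ u∈S)) 0<u
        (extend e (- (+ 3)) t∈ (inj₂ h∉) (inj₂ (refl , t∈)) (lower (values e) 0<F)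
          (λ x → rearrange (δ (tail e) x) (δ (head e) x)) transfer)
      where
      rearrange : ∀ t h → - (+ 3) * (t - h) ≡ + 3 * (h - t)
      rearrange = solve-∀
    ... | no no-out
      with any? (λ e → (head e Subset.∈? S) ×-dec (¬? (tail e Subset.∈? S)) ×-dec (F e <? 0ℤ))
    ... | yes (e , h∈ , t∉ , F<0) =
      search (⁅ tail e ⁆ ∪ S) (rec (Subset.x∈p∪q⁺ ∘ inj₂ , tail e , Subset.x∈p∪q⁺ (inj₁ (Subset.x∈⁅x⁆ _)) , t∉))
        (Subset.x∈p∪q⁺ (inj₂ u∈S)) 0<u
        (extend e (+ 3) h∈ (inj₁ t∉) (inj₁ (refl , h∈)) (raise (values e) F<0) (λ x → refl) transfer)
    ... | no no-in = ⊥-elim (ℤ.<⇒≱ (nonneg-positive S u∈S 0<u λ v v∈S → ℤ.≮⇒≥ λ v<0 → none (v , v∈S , v<0))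
        (closed-nonpositive S (λ e t∈ h∉ → ℤ.≮⇒≥ λ 0<F → no-out (e , t∈ , h∉ , 0<F))
                              (λ e h∈ t∉ → ℤ.≮⇒≥ λ F<0 → no-in (e , h∈ , t∉ , F<0))))

    push : 0ℤ < ∂ F u → ∃ λ w → ∂ F w < 0ℤ × ∃ λ S → Transfer S w
    push 0<u = search ⁅ u ⁆ (⊃-wellFounded _) (Subset.x∈⁅x⁆ u) 0<u
      λ w∈ → subst (Transfer ⁅ u ⁆) (sym (Subset.x∈⁅y⁆⇒x≡y u w∈)) record
        { F′ = F; values′ = values
        ; ∂F′ = λ v → rearrange (∂ F v) (δ u v); same = λ _ _ → refl }
      where
      rearrange : ∀ f d → f ≡ f + + 3 * (d - d)
      rearrange = solve-∀

  ∂-total : ∀ F → ∑ vertices (∂ F) ≡ 0ℤ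
  ∂-total F = begin
    ∑ vertices (∂ F)                    ≡⟨ ∑-≗ vertices (λ v → sym (ℤ.*-identityˡ _)) ⟩
    ⟨ (λ _ → 1ℤ) , ∂ F ⟩                ≡⟨ ⟨⟩-∂ (λ _ → 1ℤ) F ⟩
    ∑[ e ← edges ] (F e * 0ℤ)           ≡⟨ ∑-≗ edges (λ e → ℤ.*-zeroʳ (F e)) ⟩
    ∑[ e ← edges ] 0ℤ                   ≡⟨ ∑-zero edges ⟩
    0ℤ                                  ∎
    where open ≡-Reasoning

  nonpositive⇒zero : ∀ F → (∀ v → ∂ F v ≤ 0ℤ) → ∀ v → ∂ F v ≡ 0ℤ
  nonpositive⇒zero F ≤0 v with ∂ F v <? 0ℤ
  ... | no  ≮0 = ℤ.≤-antisym (≤0 v) (ℤ.≮⇒≥ ≮0)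
  ... | yes <0 = ⊥-elim (ℤ.<-irrefl refl (ℤ.≤-<-trans (ℤ.≤-reflexive (sym (∂-total F)))
                   (ℤ.<-≤-trans (∑-< vertices ≤0 (∈-allFin v) <0) (ℤ.≤-reflexive (∑-zero vertices)))))

  excess : (Edge → ℤ) → ℤ
  excess F = ∑[ v ← vertices ] + ∣ ∂ F v ∣

  -- All boundary values are multiples of 3, so moving 3 from a positive to a negative vertex brings
  -- both strictly closer to 0 and leaves the others alone.
  excess-decreases : ∀ F F′ {u w} → (∀ v → + 3 ∣ ∂ F v) → 0ℤ < ∂ F u → ∂ F w < 0ℤ →
                     (∀ v → ∂ F′ v ≡ ∂ F v + + 3 * (δ w v - δ u v)) → excess F′ < excess F
  excess-decreases F F′ {u} {w} 3∣ 0<u w<0 ∂F′ = ∑-< vertices smaller (∈-allFin u) smaller-at-u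
    where
    w≢u : w ≢ u
    w≢u refl = ℤ.<-asym 0<u w<0
    smaller-at-u : + ∣ ∂ F′ u ∣ < + ∣ ∂ F u ∣
    smaller-at-u rewrite ∂F′ u | δ-≢ w≢u | δ-refl u = shrink⁺ (3∣ u) 0<u
    smaller : ∀ v → + ∣ ∂ F′ v ∣ ≤ + ∣ ∂ F v ∣
    smaller v with u ≟ v | w ≟ v
    ... | yes refl | _        = ℤ.<⇒≤ smaller-at-u
    ... | no  u≢v  | yes refl rewrite ∂F′ w | δ-refl w | δ-≢ u≢v = ℤ.<⇒≤ (shrink⁻ (3∣ w) w<0)
    ... | no  u≢v  | no w≢v   rewrite ∂F′ v | δ-≢ w≢v | δ-≢ u≢v =
      ℤ.≤-reflexive (cong (λ x → + ∣ x ∣) (ℤ.+-identityʳ (∂ F v)))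

  -- `N` is fuel bounding the excess. Without a positive vertex the boundary vanishes, because its
  -- total is 0.
  integral : ∀ N F → excess F < + N → Values F → (∀ v → + 3 ∣ ∂ F v) →
             ∃ λ F′ → Values F′ × (∀ v → ∂ F′ v ≡ 0ℤ)
  integral N F M<N values 3∣ with any? (λ u → 0ℤ <? ∂ F u)
  ... | no none = F , values , nonpositive⇒zero F λ v → ℤ.≮⇒≥ λ 0<v → none (v , 0<v)
  integral zero F M<0 values 3∣ | yes _ = ⊥-elim (ℤ.<⇒≱ M<0 (0≤∑ vertices λ _ → +≤+ ℕ.z≤n))
  integral (suc N) F M<N values 3∣ | yes (u , 0<u) with Push.push F values u 0<u
  ... | w , w<0 , _ , transfer =
    integral N F′ (ℤ.<-≤-trans (excess-decreases F F′ 3∣ 0<u w<0 ∂F′) (ℤ.i<j⇒i≤pred[j] M<N)) values′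
      λ v → subst (+ 3 ∣_) (sym (∂F′ v)) (∣m∣n⇒∣m+n (3∣ v) (∣m⇒∣m*n _ (divides 1ℤ refl)))
    where open Push.Transfer transfer

  sumOver-∑ : ∀ f es → sumOver G f es ≡ ∑ es f
  sumOver-∑ f []       = refl
  sumOver-∑ f (e ∷ es) = addˡ (f e) (sumOver-∑ f es)

  ∂-split : ∀ F v → ∂ F v ≡ (∑[ e ← edges ] (F e * δ (tail e) v)) - (∑[ e ← edges ] (F e * δ (head e) v))
  ∂-split F v = begin
    ∑[ e ← edges ] (F e * (δ (tail e) v - δ (head e) v))
      ≡⟨ ∑-≗ edges (λ e → rearrange (F e) (δ (tail e) v) (δ (head e) v)) ⟩
    ∑[ e ← edges ] (F e * δ (tail e) v + -1ℤ * (F e * δ (head e) v))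
      ≡⟨ trans (∑-+ edges _ _) (addˡ (∑[ e ← edges ] (F e * δ (tail e) v)) (trans (∑-* edges -1ℤ _) (ℤ.-1*i≡-i _))) ⟩
    (∑[ e ← edges ] (F e * δ (tail e) v)) - (∑[ e ← edges ] (F e * δ (head e) v)) ∎
    where
    open ≡-Reasoning
    rearrange : ∀ a b c → a * (b - c) ≡ a * b + -1ℤ * (a * c)
    rearrange = solve-∀

  toFlow : ∀ F → Values F → (∀ v → ∂ F v ≡ 0ℤ) → NowhereZero3Flow G
  toFlow F values ∂F≡0 = record
    { orientation  = record { tail = tail; head = head; joins = λ e → inj₁ refl }
    ; flow         = F
    ; values       = λ e → value∈ (values e)
    ; conservation = λ v → begin
        sumOver G F (filter (λ e → tail e ≟ v) edges)
          ≡⟨ trans (sumOver-∑ F (filter (λ e → tail e ≟ v) edges)) (at tail v) ⟩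
        ∑[ e ← edges ] (F e * δ (tail e) v)
          ≡⟨ ℤ.i-j≡0⇒i≡j _ _ (trans (sym (∂-split F v)) (∂F≡0 v)) ⟩
        ∑[ e ← edges ] (F e * δ (head e) v)
          ≡⟨ trans (sumOver-∑ F (filter (λ e → head e ≟ v) edges)) (at head v) ⟨
        sumOver G F (filter (λ e → head e ≟ v) edges) ∎
    }
    where
    open ≡-Reasoning
    at : (end : Edge → Vertex) → ∀ v → ∑ (filter (λ e → end e ≟ v) edges) F ≡ ∑[ e ← edges ] (F e * δ (end e) v)
    at end v = ∑-filter (λ e → end e ≟ v) F
      (λ { {e} refl → trans (cong (F e *_) (δ-refl (end e))) (ℤ.*-identityʳ _) })
      (λ {e} ≢v → trans (cong (F e *_) (δ-≢ ≢v)) (ℤ.*-zeroʳ (F e)))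
      edges

  mod3-flow⇒flow : ∀ F → Values F → (∀ v → + 3 ∣ ∂ F v) → NowhereZero3Flow G
  mod3-flow⇒flow F values 3∣ =
    let F′ , values′ , ∂F′≡0 = integral (suc ∣ excess F ∣) F bound values 3∣ in toFlow F′ values′ ∂F′≡0
    where
    bound : excess F < + suc ∣ excess F ∣
    bound = ℤ.≤-<-trans (ℤ.≤-reflexive (sym (ℤ.0≤i⇒+∣i∣≡i (0≤∑ vertices λ _ → +≤+ ℕ.z≤n)))) (+<+ (ℕ.n<1+n _))

  -- Starting from an edge rather than a triangle lets every triangle arise from an `add`, with its
  -- own last vertex, and leaves a base case without triangles.
  data TwoTree : List Vertex → List Edge → Set where
    edge : ∀ {a y z} → Joins a y z → TwoTree (y ∷ z ∷ []) (a ∷ [])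
    add  : ∀ {vs es x y z a b c} → TwoTree vs es → a ∈ es → Joins a y z →
           x ∉ vs → Joins b x y → Joins c x z → TwoTree (x ∷ vs) (b ∷ c ∷ es)

  -- Boundaries modulo 3 realised on the edges of a two-tree.

  _⇝_ : Vertex → Vertex → Vertex → ℤ
  (u ⇝ v) w = δ u w - δ v w

  joins-inc : ∀ {e u v} → Joins e u v → (∀ x → inc e x ≡ (u ⇝ v) x) ⊎ (∀ x → inc e x ≡ - (u ⇝ v) x)
  joins-inc (inj₁ eq) = inj₁ λ x → cong (λ p → (proj₁ p ⇝ proj₂ p) x) eq
  joins-inc {u = u} {v} (inj₂ eq) = inj₂ λ x →
    trans (cong (λ p → (proj₁ p ⇝ proj₂ p) x) eq) (rearrange (δ u x) (δ v x))
    where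
    rearrange : ∀ a b → b - a ≡ - (a - b)
    rearrange = solve-∀

  neg*neg : ∀ k d → - k * - d ≡ k * d
  neg*neg = solve-∀

  neg*swap : ∀ k d → k * - d ≡ - k * d
  neg*swap = solve-∀

  along : ∀ {e u v} → Joins e u v → ∀ p → ∃ λ k → (Unit p → Unit k) × (∀ x → k * inc e x ≡ p * (u ⇝ v) x)
  along {u = u} {v} j p with joins-inc j
  ... | inj₁ eq = p , (λ unit → unit) , λ x → cong (p *_) (eq x)
  ... | inj₂ eq = - p , neg-unit , λ x → trans (cong (- p *_) (eq x)) (neg*neg p ((u ⇝ v) x))

  against : ∀ {e u v} → Joins e u v → ∀ k → ∃ λ p → (Unit k → Unit p) × (∀ x → k * inc e x ≡ p * (u ⇝ v) x)
  against {u = u} {v} j k with joins-inc j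
  ... | inj₁ eq = k , (λ unit → unit) , λ x → cong (k *_) (eq x)
  ... | inj₂ eq = - k , neg-unit , λ x → trans (cong (k *_) (eq x)) (neg*swap k ((u ⇝ v) x))

  -- β is congruent modulo 3 to a sum of multiples k_e · inc e with coefficients k_e in P.
  Attains : (ℤ → Set) → List Edge → (Vertex → ℤ) → Set
  Attains P []       β = ∀ v → + 3 ∣ β v
  Attains P (e ∷ es) β = ∃ λ k → P k × Attains P es (λ v → β v - k * inc e v)

  Spans Solves : List Edge → (Vertex → ℤ) → Set
  Spans  = Attains (λ _ → ⊤)
  Solves = Attains Unit

  attains-resp : ∀ {P β γ} es → (∀ v → + 3 ∣ γ v - β v) → Attains P es β → Attains P es γ
  attains-resp []       γ≈β att = λ v → ∣-resp (γ≈β v) (att v)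
  attains-resp {β = β} {γ} (e ∷ es) γ≈β (k , p , att) =
    k , p , attains-resp es (λ v → subst (+ 3 ∣_) (rearrange (γ v) (β v) (k * inc e v)) (γ≈β v)) att
    where
    rearrange : ∀ g b i → g - b ≡ g - i - (b - i)
    rearrange = solve-∀

  attains-≗ : ∀ {P β γ} es → (∀ v → γ v ≡ β v) → Attains P es β → Attains P es γ
  attains-≗ {β = β} es γ≗β = attains-resp es λ v →
    divides 0ℤ (trans (cong (_- β v) (γ≗β v)) (ℤ.+-inverseʳ (β v)))

  spans-+ : ∀ {β γ} es → Spans es β → Spans es γ → Spans es (λ v → β v + γ v)
  spans-+ []       sβ sγ = λ v → ∣m∣n⇒∣m+n (sβ v) (sγ v)
  spans-+ {β} {γ} (e ∷ es) (k , _ , sβ) (l , _ , sγ) =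
    k + l , tt , attains-≗ es (λ v → rearrange (β v) (γ v) k l (inc e v)) (spans-+ es sβ sγ)
    where
    rearrange : ∀ b g k l i → b + g - (k + l) * i ≡ (b - k * i) + (g - l * i)
    rearrange = solve-∀

  spans-0 : ∀ es {β} → (∀ v → β v ≡ 0ℤ) → Spans es β
  spans-0 [] β≡0 v = divides 0ℤ (β≡0 v)
  spans-0 (e ∷ es) {β} β≡0 = 0ℤ , tt , spans-0 es λ v → trans (ℤ.+-identityʳ (β v)) (β≡0 v)

  spans-inc : ∀ {a es} r → a ∈ es → Spans es (λ v → r * inc a v)
  spans-inc {a} {_ ∷ es} r (here refl) = r , tt , spans-0 es λ v → ℤ.+-inverseʳ (r * inc a v)
  spans-inc {a} {e ∷ es} r (there a∈es) =
    0ℤ , tt , attains-≗ es (λ v → ℤ.+-identityʳ (r * inc a v)) (spans-inc r a∈es)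

  spans-⇝ : ∀ {a y z es} r → Joins a y z → a ∈ es → Spans es (λ v → r * (y ⇝ z) v)
  spans-⇝ {es = es} r j a∈es = let k , _ , eq = along j r in attains-≗ es (λ v → sym (eq v)) (spans-inc k a∈es)

  -- Negating a unit changes it by itself modulo 3.
  flip : ∀ {a es β} → a ∈ es → Solves es β → ∃ λ u → Unit u × Solves es (λ v → β v + u * inc a v)
  flip {a} {_ ∷ es} {β} (here refl) (k , unit , s) =
    k , unit , - k , neg-unit unit , attains-resp es (λ v → divides (k * inc a v) (rearrange (β v) k (inc a v))) s
    where
    rearrange : ∀ b k i → b + k * i - - k * i - (b - k * i) ≡ k * i * + 3
    rearrange = solve-∀
  flip {a} {e ∷ es} {β} (there a∈es) (k , unit , s) with flip a∈es s
  ... | u , unit-u , s′ = u , unit-u , k , unit , attains-≗ es (λ v → rearrange (β v) (u * inc a v) (k * inc e v)) s′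
    where
    rearrange : ∀ b i j → b + i - j ≡ b - j + i
    rearrange = solve-∀

  module Triangle {x y z a b c es} (a∈es : a ∈ es) (ja : Joins a y z) (jb : Joins b x y) (jc : Joins c x z) where

    rest : (Vertex → ℤ) → ℤ → ℤ → Vertex → ℤ
    rest β p q v = β v - p * (x ⇝ y) v - q * (x ⇝ z) v

    attach : ∀ β p q → Unit p → Unit q → Solves es (rest β p q) → Solves (b ∷ c ∷ es) β
    attach β p q unit-p unit-q s =
      let k , unit-k , eq-k = along jb p ; l , unit-l , eq-l = along jc q in
      k , unit-k unit-p , l , unit-l unit-q ,
      attains-≗ es (λ v → cong₂ (λ i j → β v - i - j) (eq-k v) (eq-l v)) s

    detach : ∀ β → Spans (b ∷ c ∷ es) β → ∃ λ p → ∃ λ q → Spans es (rest β p q)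
    detach β (k , _ , l , _ , s) =
      let p , _ , eq-p = against jb k ; q , _ , eq-q = against jc l in
      p , q , attains-≗ es (λ v → sym (cong₂ (λ i j → β v - i - j) (eq-p v) (eq-q v))) s

    -- Pushing a value around the triangle changes the coefficients of b and c by opposite amounts.
    reroute : ∀ β p q p′ q′ → + 3 ∣ p + q - (p′ + q′) → Spans es (rest β p q) → Spans es (rest β p′ q′)
    reroute β p q p′ q′ (divides m eq) s =
      attains-resp es (λ v → divides (m * (x ⇝ z) v)
          (trans (rearrange (β v) (δ x v) (δ y v) (δ z v) p q p′ q′)
            (trans (cong (_* (x ⇝ z) v) eq) (shift3 m ((x ⇝ z) v)))))
        (spans-+ es s (spans-⇝ (p′ - p) ja a∈es))
      where
      rearrange : ∀ b x y z p q p′ q′ →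
        b - p′ * (x - y) - q′ * (x - z) - (b - p * (x - y) - q * (x - z) + (p′ - p) * (y - z))
          ≡ (p + q - (p′ + q′)) * (x - z)
      rearrange = solve-∀

    -- Opposite signs `- u` and `u` on `b` and `c` act like the value `u` sent from `y` to `z`,
    -- parallel to `a`, with `u` still free. The given solution on `es` leaves a residue `r = q + j`
    -- along that line, so it is enough that `r` be a unit modulo 3.
    balanced : ∀ β p q → + 3 ∣ p + q → (∃ λ k → Solves es (λ v → rest β p q v - k * inc a v)) → Solves (b ∷ c ∷ es) β
    balanced β p q (divides m eq) (k , s) = solve-with j (attains-resp es close s)
      where
      j = proj₁ (against ja k)
      close : ∀ v → + 3 ∣ (β v - (q + j) * (y ⇝ z) v) - (rest β p q v - k * inc a v)
      close v rewrite proj₂ (proj₂ (against ja k)) v = divides (m * (x ⇝ y) v)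
          (trans (rearrange (β v) (δ x v) (δ y v) (δ z v) p q j)
            (trans (cong (_* (x ⇝ y) v) eq) (shift3 m ((x ⇝ y) v))))
        where
        rearrange : ∀ b x y z p q j →
          b - (q + j) * (y - z) - (b - p * (x - y) - q * (x - z) - j * (y - z)) ≡ (p + q) * (x - y)
        rearrange = solve-∀
      finish : ∀ r u → Unit u → + 3 ∣ r - u → Solves es (λ v → β v - r * (y ⇝ z) v) → Solves (b ∷ c ∷ es) β
      finish r u unit (divides n eq′) s′ =
          attach β (- u) u (neg-unit unit) unit (attains-resp es (λ v → divides (n * (y ⇝ z) v)
          (trans (rearrange (β v) (δ x v) (δ y v) (δ z v) r u)
            (trans (cong (_* (y ⇝ z) v) eq′) (shift3 n ((y ⇝ z) v))))) s′)
        where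
        rearrange : ∀ b x y z r u →
          b - - u * (x - y) - u * (x - z) - (b - r * (y - z)) ≡ (r - u) * (y - z)
        rearrange = solve-∀
      solve-with : ∀ j → Solves es (λ v → β v - (q + j) * (y ⇝ z) v) → Solves (b ∷ c ∷ es) β
      solve-with j s with unit-or-zero (q + j)
      ... | inj₁ (u , unit , d) = finish (q + j) u unit d s
      -- The residue is 0: reversing the sign on `a` turns it into `- w` for a unit `w`, which the
      -- pair `b`, `c` can carry.
      ... | inj₂ d with flip a∈es s
      ...   | u , unit , s′ with against ja u
      ...     | w , unit-w , eq-w = finish (q + j - w) (- w) (neg-unit (unit-w unit))
                  (subst (+ 3 ∣_) (rearrange (q + j) w) d)
                  (attains-≗ es (λ v → trans (regroup (β v) (q + j) w ((y ⇝ z) v))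
                     (addˡ (β v - (q + j) * (y ⇝ z) v) (sym (eq-w v)))) s′)
        where
        rearrange : ∀ r w → r ≡ r - w - - w
        rearrange = solve-∀
        regroup : ∀ b r w d → b - (r - w) * d ≡ b - r * d + w * d
        regroup = solve-∀

  -- One edge with an arbitrary extra multiple removes every obstruction. If that edge is old, only
  -- the sum `p + q` matters, by `reroute`, and two units on `b` and `c` attain it. If it is new,
  -- its multiple is used to make the sum vanish, as `balanced` requires.
  free-edge : ∀ {vs es a β} → TwoTree vs es → a ∈ es → Spans es β → ∃ λ k → Solves es (λ v → β v - k * inc a v)
  free-edge {a = a} {β} (edge _) (here refl) (p , _ , s) =
    p - 1ℤ , 1ℤ , +1u , λ v → subst (+ 3 ∣_) (rearrange (β v) p (inc a v)) (s v)
    where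
    rearrange : ∀ b p i → b - p * i ≡ b - (p - 1ℤ) * i - 1ℤ * i
    rearrange = solve-∀
  free-edge {a = a′} {β} (add {es = es} {x} {y} {z} T a∈es ja _ jb jc) (there (there a′∈es)) s =
    let p , q , s₁ = detach β s
        p′ , q′ , unit-p , unit-q , d = two-units (p + q)
        k , s₂ = free-edge T a′∈es (reroute β p q p′ q′ d s₁)
    in k , attach (λ v → β v - k * inc a′ v) p′ q′ unit-p unit-q
             (attains-≗ es (λ v → rearrange (β v) (k * inc a′ v) (p′ * (x ⇝ y) v) (q′ * (x ⇝ z) v)) s₂)
    where
    open Triangle a∈es ja jb jc
    rearrange : ∀ b i j l → b - i - j - l ≡ b - j - l - i
    rearrange = solve-∀
  free-edge {a = b} {β} (add {es = es} {x} {y} {z} T a∈es ja _ jb jc) (here refl) s =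
    let p , q , s₁ = detach β s
        -- Removing `p + q` from the coefficient `p` of `b` leaves `- q`, opposite to that of `c`.
        k , _ , eq = along jb (p + q)
    in k , balanced (λ v → β v - k * inc b v) (- q) q (divides 0ℤ (ℤ.+-inverseˡ q)) (free-edge T a∈es (attains-≗ es
             (λ v → trans (cong (λ i → β v - i - - q * (x ⇝ y) v - q * (x ⇝ z) v) (eq v))
                          (rearrange (β v) p q ((x ⇝ y) v) (q * (x ⇝ z) v))) s₁))
    where
    open Triangle a∈es ja jb jc
    rearrange : ∀ b p q d r → b - (p + q) * d - - q * d - r ≡ b - p * d - r
    rearrange = solve-∀
  free-edge {a = c} {β} (add {es = es} {x} {y} {z} T a∈es ja _ jb jc) (there (here refl)) s =
    let p , q , s₁ = detach β s
        k , _ , eq = along jc (p + q)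
    in k , balanced (λ v → β v - k * inc c v) p (- p) (divides 0ℤ (ℤ.+-inverseʳ p)) (free-edge T a∈es (attains-≗ es
             (λ v → trans (cong (λ i → β v - i - p * (x ⇝ y) v - - p * (x ⇝ z) v) (eq v))
                          (rearrange (β v) p q ((x ⇝ z) v) (p * (x ⇝ y) v))) s₁))
    where
    open Triangle a∈es ja jb jc
    rearrange : ∀ b p q d r → b - (p + q) * d - r - - p * d ≡ b - r - q * d
    rearrange = solve-∀

  -- Incidence, distinctness and connectedness in two-trees.

  infix 4 _∈?_
  _∈?_ : (e : Edge) (es : List Edge) → Dec (e ∈ es)
  _∈?_ = DecMembership._∈?_ _≟_

  tail≢head : ∀ {e u v} → Joins e u v → u ≢ v
  tail≢head {e} (inj₁ eq) refl = loopless e (trans (cong proj₁ eq) (sym (cong proj₂ eq)))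
  tail≢head {e} (inj₂ eq) refl = loopless e (trans (cong proj₁ eq) (sym (cong proj₂ eq)))

  joins-ends : ∀ {e u v} {P : Vertex → Set} → Joins e u v → P u → P v → P (tail e) × P (head e)
  joins-ends {P = P} (inj₁ eq) pu pv = subst P (sym (cong proj₁ eq)) pu , subst P (sym (cong proj₂ eq)) pv
  joins-ends {P = P} (inj₂ eq) pu pv = subst P (sym (cong proj₁ eq)) pv , subst P (sym (cong proj₂ eq)) pu

  ends-joins : ∀ {e u v} {P : Vertex → Set} → Joins e u v → P (tail e) → P (head e) → P u × P v
  ends-joins {P = P} (inj₁ eq) pt ph = subst P (cong proj₁ eq) pt , subst P (cong proj₂ eq) ph
  ends-joins {P = P} (inj₂ eq) pt ph = subst P (cong proj₂ eq) ph , subst P (cong proj₁ eq) pt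

  ends∈ : ∀ {vs es e} → TwoTree vs es → e ∈ es → tail e ∈ vs × head e ∈ vs
  joined∈ : ∀ {vs es a y z} → TwoTree vs es → a ∈ es → Joins a y z → y ∈ vs × z ∈ vs

  ends∈ (edge ja) (here refl) = joins-ends {P = _∈ _} ja (here refl) (there (here refl))
  ends∈ (add T a∈es ja x∉vs jb jc) (here refl) =
    joins-ends {P = _∈ _} jb (here refl) (there (proj₁ (joined∈ T a∈es ja)))
  ends∈ (add T a∈es ja x∉vs jb jc) (there (here refl)) =
    joins-ends {P = _∈ _} jc (here refl) (there (proj₂ (joined∈ T a∈es ja)))
  ends∈ (add T a∈es ja x∉vs jb jc) (there (there e∈es)) =
    let t , h = ends∈ T e∈es in there t , there h

  joined∈ T a∈es ja = let t , h = ends∈ T a∈es in ends-joins {P = _∈ _} ja t h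

  unique-vertices : ∀ {vs es} → TwoTree vs es → Unique vs
  unique-vertices (edge ja) = (tail≢head ja ∷ []) ∷ ([] ∷ [])
  unique-vertices (add T _ _ x∉vs _ _) = All.¬Any⇒All¬ _ x∉vs ∷ unique-vertices T

  new-edge∉ : ∀ {vs es b x y} → TwoTree vs es → x ∉ vs → Joins b x y → b ∉ es
  new-edge∉ T x∉vs jb b∈es = x∉vs (proj₁ (joined∈ T b∈es jb))

  other-end : ∀ {e x y z} → Joins e x y → Joins e x z → y ≡ z
  other-end (inj₁ p) (inj₁ q) = cong proj₂ (trans (sym p) q)
  other-end (inj₁ p) (inj₂ q) = trans (cong proj₂ (trans (sym p) q)) (cong proj₁ (trans (sym p) q))
  other-end (inj₂ p) (inj₁ q) = trans (cong proj₁ (trans (sym p) q)) (cong proj₂ (trans (sym p) q))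
  other-end (inj₂ p) (inj₂ q) = cong proj₁ (trans (sym p) q)

  unique-edges : ∀ {vs es} → TwoTree vs es → Unique es
  unique-edges (edge ja) = [] ∷ []
  unique-edges (add T a∈es ja x∉vs jb jc) =
    ((λ { refl → tail≢head ja (other-end jb jc) }) ∷ All.¬Any⇒All¬ _ (new-edge∉ T x∉vs jb))
      ∷ All.¬Any⇒All¬ _ (new-edge∉ T x∉vs jc) ∷ unique-edges T

  inc-off : ∀ {e x} → tail e ≢ x → head e ≢ x → inc e x ≡ 0ℤ
  inc-off t≢x h≢x = cong₂ _-_ (δ-≢ t≢x) (δ-≢ h≢x)

  tree-inc-off : ∀ {vs es x e} → TwoTree vs es → x ∉ vs → e ∈ es → inc e x ≡ 0ℤ
  tree-inc-off {e = e} T x∉vs e∈es = let t , h = ends∈ T e∈es in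
    inc-off {e} (λ { refl → x∉vs t }) (λ { refl → x∉vs h })

  spans-off : ∀ {x β} es → (∀ {e} → e ∈ es → inc e x ≡ 0ℤ) → Spans es β → + 3 ∣ β x
  spans-off []       off s = s _
  spans-off {x} {β} (e ∷ es) off (k , _ , s) =
    subst (+ 3 ∣_) (trans (cong (λ i → β x - k * i) (off (here refl))) (rearrange (β x) k))
      (spans-off es (off ∘ there) s)
    where
    rearrange : ∀ b k → b - k * 0ℤ ≡ b
    rearrange = solve-∀

  spans-* : ∀ {β} k es → Spans es β → Spans es (λ v → k * β v)
  spans-* k []       s = λ v → ∣n⇒∣m*n k (s v)
  spans-* {β} k (e ∷ es) (l , _ , s) =
    k * l , tt , attains-≗ es (λ v → rearrange k (β v) l (inc e v)) (spans-* k es s)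
    where
    rearrange : ∀ k b l i → k * b - k * l * i ≡ k * (b - l * i)
    rearrange = solve-∀

  spans-∑ : ∀ {A : Set} {β : A → Vertex → ℤ} es (xs : List A) → (∀ x → Spans es (β x)) →
            Spans es (λ v → ∑[ x ← xs ] β x v)
  spans-∑ es []       s = spans-0 es (λ v → refl)
  spans-∑ es (x ∷ xs) s = spans-+ es (s x) (spans-∑ es xs s)

  spans-weaken : ∀ β e es → Spans es β → Spans (e ∷ es) β
  spans-weaken β e es s = 0ℤ , tt , attains-≗ es (λ v → ℤ.+-identityʳ (β v)) s

  root : ∀ {vs es} → TwoTree vs es → Vertex
  root (edge {z = z} _)     = z
  root (add T _ _ _ _ _) = root T

  spans-root : ∀ {vs es u} (T : TwoTree vs es) → u ∈ vs → Spans es (u ⇝ root T)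
  spans-root (edge {a} {y} {z} ja) (here refl) =
    attains-≗ (a ∷ []) (λ v → sym (ℤ.*-identityˡ ((y ⇝ z) v))) (spans-⇝ 1ℤ ja (here refl))
  spans-root {es = es} (edge {z = z} ja) (there (here refl)) = spans-0 es λ v → ℤ.+-inverseʳ (δ z v)
  spans-root {es = es} (add {es = es′} {x} {y} {b = b} {c} T a∈es ja _ jb _) (here refl) =
    attains-≗ es (λ v → rearrange (δ x v) (δ y v) (δ (root T) v))
      (spans-+ {λ v → 1ℤ * (x ⇝ y) v} {y ⇝ root T} es (spans-⇝ 1ℤ jb (here refl))
        (spans-weaken (y ⇝ root T) b (c ∷ es′)
          (spans-weaken (y ⇝ root T) c es′ (spans-root T (proj₁ (joined∈ T a∈es ja))))))
    where
    rearrange : ∀ x y r → x - r ≡ 1ℤ * (x - y) + (y - r)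
    rearrange = solve-∀
  spans-root {u = u} (add {es = es} {b = b} {c} T _ _ _ _ _) (there u∈vs) =
    spans-weaken (u ⇝ root T) b (c ∷ es) (spans-weaken (u ⇝ root T) c es (spans-root T u∈vs))

  spans-all : ∀ {vs es} (T : TwoTree vs es) → (∀ v → v ∈ vs) → ∀ e → Spans es (inc e)
  spans-all {es = es} T all e =
    attains-≗ es (λ v → rearrange (δ (tail e) v) (δ (head e) v) (δ (root T) v))
      (spans-+ es (spans-root T (all (tail e))) (spans-* -1ℤ es (spans-root T (all (head e)))))
    where
    rearrange : ∀ t h r → t - h ≡ (t - r) + -1ℤ * (h - r)
    rearrange = solve-∀

  -- The colouring, the dual vectors and their behaviour under a new vertex.

  ext : Vertex → Vertex → Vertex → (Vertex → ℤ) → Vertex → ℤ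
  ext x y z g v = g v + - (g x + g y + g z) * δ x v

  -- The first edge gets the colours 1 and -1, and `ext` gives each new vertex the third colour, so
  -- colours sum to 0 over ℤ on every triangle.
  χ : ∀ {vs es} → TwoTree vs es → Vertex → ℤ
  χ (edge {y = y} {z} _)                   = y ⇝ z
  χ (add {x = x} {y} {z} T _ _ _ _ _) = ext x y z (χ T)

  triangle-at : Vertex → Vertex → Vertex → Vertex → ℤ
  triangle-at x y z v = δ x v + δ y v + δ z v

  -- Pairs (1_t , g_t): the vector g_t has sum 1 on the triangle t and sum 0 on every other triangle.
  basis : ∀ {vs es} → TwoTree vs es → List ((Vertex → ℤ) × (Vertex → ℤ))
  basis (edge _) = []
  basis (add {x = x} {y} {z} T _ _ _ _ _) = (triangle-at x y z , δ x) ∷ map (map₂ (ext x y z)) (basis T)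

  ⟨⟩-comm : ∀ g β → ⟨ g , β ⟩ ≡ ⟨ β , g ⟩
  ⟨⟩-comm g β = ∑-≗ vertices λ v → ℤ.*-comm (g v) (β v)

  ⟨⟩-+kδ : ∀ g k x β → ⟨ (λ v → g v + k * δ x v) , β ⟩ ≡ ⟨ g , β ⟩ + k * β x
  ⟨⟩-+kδ g k x β = begin
    ⟨ (λ v → g v + k * δ x v) , β ⟩         ≡⟨ ⟨⟩-comm (λ v → g v + k * δ x v) β ⟩
    ⟨ β , (λ v → g v + k * δ x v) ⟩         ≡⟨ ⟨⟩-+ β g (λ v → k * δ x v) ⟩
    ⟨ β , g ⟩ + ⟨ β , (λ v → k * δ x v) ⟩
      ≡⟨ cong₂ _+_ (⟨⟩-comm β g) (trans (⟨⟩-* β k (δ x)) (cong (k *_) (⟨⟩-δ β x))) ⟩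
    ⟨ g , β ⟩ + k * β x                     ∎
    where open ≡-Reasoning

  ⟨δ⟩ : ∀ x β → ⟨ δ x , β ⟩ ≡ β x
  ⟨δ⟩ x β = trans (⟨⟩-comm (δ x) β) (⟨⟩-δ β x)

  ⟨⟩-⇝ : ∀ g u v → ⟨ g , u ⇝ v ⟩ ≡ g u - g v
  ⟨⟩-⇝ g u v = begin
    ⟨ g , u ⇝ v ⟩                          ≡⟨ ⟨⟩-cong g (λ w → addˡ (δ u w) (sym (ℤ.-1*i≡-i (δ v w)))) ⟩
    ⟨ g , (λ w → δ u w + -1ℤ * δ v w) ⟩
      ≡⟨ trans (⟨⟩-+ g (δ u) (λ w → -1ℤ * δ v w)) (cong₂ _+_ (⟨⟩-δ g u) (⟨⟩-* g -1ℤ (δ v))) ⟩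
    g u + -1ℤ * ⟨ g , δ v ⟩                ≡⟨ addˡ (g u) (trans (ℤ.-1*i≡-i ⟨ g , δ v ⟩) (cong -_ (⟨⟩-δ g v))) ⟩
    g u - g v                              ∎
    where open ≡-Reasoning

  module _ {x y z a b c es} (a∈es : a ∈ es) (ja : Joins a y z) (jb : Joins b x y) (jc : Joins c x z) where
    open Triangle a∈es ja jb jc

    rest-at-new : ∀ β p q → rest β p q x ≡ β x - (p + q)
    rest-at-new β p q rewrite δ-refl x | δ-≢ (tail≢head jb ∘ sym) | δ-≢ (tail≢head jc ∘ sym) = rearrange (β x) p q
      where
      rearrange : ∀ b p q → b - p * 1ℤ - q * 1ℤ ≡ b - (p + q)
      rearrange = solve-∀

    ⟨⟩-rest : ∀ g β u → ⟨ g , rest β (- u) (- u) ⟩ ≡ ⟨ g , β ⟩ + u * (+ 2 * g x - g y - g z)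
    ⟨⟩-rest g β u = begin
      ⟨ g , rest β (- u) (- u) ⟩
        ≡⟨ ⟨⟩-cong g (λ v → rearrange (β v) u ((x ⇝ y) v) ((x ⇝ z) v)) ⟩
      ⟨ g , (λ v → β v + u * ((x ⇝ y) v + (x ⇝ z) v)) ⟩
        ≡⟨ trans (⟨⟩-+ g β (λ v → u * ((x ⇝ y) v + (x ⇝ z) v)))
             (addˡ ⟨ g , β ⟩ (trans (⟨⟩-* g u (λ v → (x ⇝ y) v + (x ⇝ z) v))
             (cong (u *_) (⟨⟩-+ g (x ⇝ y) (x ⇝ z))))) ⟩
      ⟨ g , β ⟩ + u * (⟨ g , x ⇝ y ⟩ + ⟨ g , x ⇝ z ⟩)
        ≡⟨ cong (λ i → ⟨ g , β ⟩ + u * i) (trans (cong₂ _+_ (⟨⟩-⇝ g x y) (⟨⟩-⇝ g x z)) (collect (g x) (g y) (g z))) ⟩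
      ⟨ g , β ⟩ + u * (+ 2 * g x - g y - g z) ∎
      where
      open ≡-Reasoning
      rearrange : ∀ b u i j → b - - u * i - - u * j ≡ b + u * (i + j)
      rearrange = solve-∀
      collect : ∀ x y z → (x - y) + (x - z) ≡ + 2 * x - y - z
      collect = solve-∀

    -- The signs `- u` on `b` and `c` change the pairing by `u * (2 g x - g y - g z)`. As 2 ≡ -1,
    -- this is `- (g x + g y + g z) * β x` modulo 3, precisely the correction in `ext`: extending
    -- `g` upwards matches forcing signs downwards.
    rest-vs-ext : ∀ g β u → + 3 ∣ β x - u → + 3 ∣ ⟨ g , rest β (- u) (- u) ⟩ - ⟨ ext x y z g , β ⟩
    rest-vs-ext g β u (divides m eq) = divides (u * g x + (g x + g y + g z) * m) (begin
      ⟨ g , rest β (- u) (- u) ⟩ - ⟨ ext x y z g , β ⟩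
        ≡⟨ cong₂ _-_ (⟨⟩-rest g β u) (⟨⟩-+kδ g (- (g x + g y + g z)) x β) ⟩
      (⟨ g , β ⟩ + u * (+ 2 * g x - g y - g z)) - (⟨ g , β ⟩ + - (g x + g y + g z) * β x)
        ≡⟨ rearrange ⟨ g , β ⟩ u (β x) (g x) (g y) (g z) ⟩
      u * g x * + 3 + (g x + g y + g z) * (β x - u)
        ≡⟨ cong (λ i → u * g x * + 3 + (g x + g y + g z) * i) eq ⟩
      u * g x * + 3 + (g x + g y + g z) * (m * + 3)
        ≡⟨ collect (u * g x) (g x + g y + g z) m ⟩
      (u * g x + (g x + g y + g z) * m) * + 3 ∎)
      where
      open ≡-Reasoning
      rearrange : ∀ p u b x y z → (p + u * (+ 2 * x - y - z)) - (p + - (x + y + z) * b)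
                                    ≡ u * x * + 3 + (x + y + z) * (b - u)
      rearrange = solve-∀
      collect : ∀ a s m → a * + 3 + s * (m * + 3) ≡ (a + s * m) * + 3
      collect = solve-∀

  -- Favourable boundaries and the flows they give.

  Favourable : ∀ {vs es} → TwoTree vs es → (Vertex → ℤ) → Set
  Favourable T β = Any (λ tg → + 3 ∣ ⟨ proj₂ tg , β ⟩) (basis T) ⊎ ¬ + 3 ∣ ⟨ χ T , β ⟩

  favourable⇒solves : ∀ {vs es} (T : TwoTree vs es) β → Spans es β → Favourable T β → Solves es β
  favourable⇒solves (edge {a} {y} {z} ja) β (p , _ , s) (inj₂ χ∤) with unit-or-zero p
  ... | inj₁ (u , unit , divides m eq) = u , unit , λ v →
    subst (+ 3 ∣_) (rearrange (β v) p u (inc a v)) (∣m∣n⇒∣m+n (s v) (∣m⇒∣m*n (inc a v) (divides m eq)))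
    where
    rearrange : ∀ b p u i → b - p * i + (p - u) * i ≡ b - u * i
    rearrange = solve-∀
  -- A coefficient that is 0 modulo 3 makes all of `β` vanish modulo 3, and with it the pairing with
  -- the colouring.
  ... | inj₂ 3∣p = ⊥-elim (χ∤ (∑-∣ vertices λ {v} _ →
    ∣n⇒∣m*n ((y ⇝ z) v) (∣-resp {x = β v} (s′ v) (∣m⇒∣m*n (inc a v) 3∣p))))
    where
    s′ : ∀ v → + 3 ∣ β v - p * inc a v
    s′ = s
  favourable⇒solves (add {es = es} {x} {y} {z} T a∈es ja x∉vs jb jc) β sβ fav
    with Triangle.detach a∈es ja jb jc β sβ
  ... | p , q , s with unit-or-zero (p + q)
  -- Here `β x` is 0 modulo 3, and the choice left open at `b` and `c` makes `free-edge` sufficient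
  -- on the smaller tree.
  ... | inj₂ 3∣p+q = Triangle.balanced a∈es ja jb jc β p q 3∣p+q (free-edge T a∈es s)
  ... | inj₁ (u , unit , d) =
    -- Only two equal units have a unit as their sum modulo 3, and `- u - u ≡ u`.
    attach β (- u) (- u) (neg-unit unit) (neg-unit unit)
      (favourable⇒solves T (rest β (- u) (- u)) (reroute β p q (- u) (- u) d′ s) (shift fav))
    where
    open Triangle a∈es ja jb jc
    d′ : + 3 ∣ p + q - (- u + - u)
    d′ = subst (+ 3 ∣_) (rearrange (p + q) u) (∣m∣n⇒∣m+n d (divides u refl))
      where
      rearrange : ∀ s u → s - u + u * + 3 ≡ s - (- u + - u)
      rearrange = solve-∀
    βx : + 3 ∣ β x - u
    βx = subst (+ 3 ∣_) (rearrange (β x) (p + q) u)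
           (∣m∣n⇒∣m+n (subst (+ 3 ∣_) (rest-at-new a∈es ja jb jc β p q) (spans-off es (tree-inc-off T x∉vs) s)) d)
      where
      rearrange : ∀ b s u → b - s + (s - u) ≡ b - u
      rearrange = solve-∀
    shift : Favourable (add T a∈es ja x∉vs jb jc) β → Favourable T (rest β (- u) (- u))
    -- The dual vector of the newest triangle is `δ x`, whose pairing `β x ≡ u` is not 0.
    shift (inj₁ (here 3∣)) = ⊥-elim (unit-∤ unit (subst (+ 3 ∣_) (cancel (β x) u)
        (∣m∣n⇒∣m-n (subst (+ 3 ∣_) (⟨δ⟩ x β) 3∣) βx)))
      where
      cancel : ∀ b u → b - (b - u) ≡ u
      cancel = solve-∀
    shift (inj₁ (there any)) =
      inj₁ (Any.map (λ {tg} → ∣-resp (rest-vs-ext a∈es ja jb jc (proj₂ tg) β u βx)) (Any.map⁻ any))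
    shift (inj₂ χ∤) = inj₂ λ 3∣ → χ∤ (∣-resp {x = ⟨ ext x y z (χ T) , β ⟩}
      (∣-neg {x = ⟨ χ T , rest β (- u) (- u) ⟩} (rest-vs-ext a∈es ja jb jc (χ T) β u βx)) 3∣)

  realise : ∀ {es} β → Unique es → Solves es β →
            ∃ λ f → (∀ {e} → e ∈ es → Unit (f e)) × (∀ {e} → e ∉ es → f e ≡ 0ℤ) × (∀ v → + 3 ∣ β v - ∂ f v)
  realise {[]} β _ s = (λ _ → 0ℤ) , (λ ()) , (λ _ → refl) , λ v →
    subst (+ 3 ∣_) (sym (trans (cong (λ i → β v - i) (∑-zero edges)) (ℤ.+-identityʳ (β v)))) (s v)
  realise {e ∷ es} β (e∉es ∷ uniq) (k , unit , s) with realise (λ v → β v - k * inc e v) uniq s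
  ... | f , on , off , ∂f = f′ , on′ , off′ , λ v →
      subst (+ 3 ∣_) (trans (rearrange (β v) (k * inc e v) (∂ f v)) (cong (λ i → β v - i) (sym (∂-+δ f e k v)))) (∂f v)
    where
    f′ : Edge → ℤ
    f′ e′ = f e′ + k * δ e e′
    rearrange : ∀ b i d → b - i - d ≡ b - (d + i)
    rearrange = solve-∀
    unchanged : ∀ {e′} → e ≢ e′ → f′ e′ ≡ f e′
    unchanged {e′} e≢e′ = trans (cong (λ i → f e′ + k * i) (δ-≢ e≢e′))
                           (trans (addˡ (f e′) (ℤ.*-zeroʳ k)) (ℤ.+-identityʳ (f e′)))
    on′ : ∀ {e′} → e′ ∈ e ∷ es → Unit (f′ e′)
    on′ (here refl) = subst Unit (sym (trans (cong₂ (λ i j → i + k * j) (off (All.All¬⇒¬Any e∉es)) (δ-refl e))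
                        (trans (ℤ.+-identityˡ (k * 1ℤ)) (ℤ.*-identityʳ k)))) unit
    on′ (there e′∈es) = subst Unit (sym (unchanged λ { refl → All.All¬⇒¬Any e∉es e′∈es })) (on e′∈es)
    off′ : ∀ {e′} → e′ ∉ e ∷ es → f′ e′ ≡ 0ℤ
    off′ e′∉ = trans (unchanged (e′∉ ∘ here ∘ sym)) (off (e′∉ ∘ there))

  mask : List Edge → Edge → ℤ
  mask es e = 1ℤ - count es e

  mask-∈ : ∀ {es e} → Unique es → e ∈ es → mask es e ≡ 0ℤ
  mask-∈ uniq e∈es = cong (λ i → 1ℤ - i) (count-∈ uniq e∈es)

  mask-∉ : ∀ {es e} → e ∉ es → mask es e ≡ 1ℤ
  mask-∉ e∉es = cong (λ i → 1ℤ - i) (count-∉ e∉es)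

  unit-value : ∀ {k} → Unit k → Value k
  unit-value +1u = +1v
  unit-value -1u = -1v

  -- The signs outside the tree have a boundary that the connected spanning tree spans. Subtracting
  -- a solution in units on the tree cancels it modulo 3 and leaves every edge with a value ±1.
  signs⇒flow : ∀ {vs es} (T : TwoTree vs es) → (∀ v → v ∈ vs) → (ε : Edge → ℤ) → (∀ e → Unit (ε e)) →
               Favourable T (∂ (λ e → mask es e * ε e)) → NowhereZero3Flow G
  signs⇒flow {es = es} T all ε units fav
    with realise β (unique-edges T) (favourable⇒solves T β spans fav)
    where
    β = ∂ (λ e → mask es e * ε e)
    spans : Spans es β
    spans = spans-∑ es edges λ e → spans-* (mask es e * ε e) es (spans-all T all e)
  ... | f , on , off , ∂f = mod3-flow⇒flow F values λ v → subst (+ 3 ∣_) (sym (∂F v)) (∂f v)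
    where
    β = ∂ (λ e → mask es e * ε e)
    F : Edge → ℤ
    F e = mask es e * ε e - f e
    ∂F : ∀ v → ∂ F v ≡ β v - ∂ f v
    ∂F v = begin
      ∂ F v
        ≡⟨ ∑-≗ edges (λ e → rearrange (mask es e * ε e) (f e) (inc e v)) ⟩
      ∑[ e ← edges ] (mask es e * ε e * inc e v + -1ℤ * (f e * inc e v))
        ≡⟨ ∑-+ edges (λ e → mask es e * ε e * inc e v) (λ e → -1ℤ * (f e * inc e v)) ⟩
      β v + (∑[ e ← edges ] (-1ℤ * (f e * inc e v)))
        ≡⟨ addˡ (β v) (trans (∑-* edges -1ℤ (λ e → f e * inc e v)) (ℤ.-1*i≡-i (∂ f v))) ⟩
      β v - ∂ f v ∎
      where
      open ≡-Reasoning
      rearrange : ∀ m f i → (m - f) * i ≡ m * i + -1ℤ * (f * i)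
      rearrange = solve-∀
    values : Values F
    values e with e ∈? es
    ... | yes e∈es = subst Value (sym (trans (cong (λ m → m * ε e - f e) (mask-∈ (unique-edges T) e∈es))
                                         (ℤ.+-identityˡ (- f e))))
                       (unit-value (neg-unit (on e∈es)))
    ... | no  e∉es = subst Value (sym (trans (cong₂ (λ m f → m * ε e - f) (mask-∉ e∉es) (off e∉es))
                       (trans (ℤ.+-identityʳ (1ℤ * ε e)) (ℤ.*-identityˡ (ε e))))) (unit-value (units e))

  -- Values of the colouring and the dual vectors over ℤ.

  ext-new : ∀ x y z g → ext x y z g x ≡ third (g y) (g z)
  ext-new x y z g = trans (cong (λ d → g x + - (g x + g y + g z) * d) (δ-refl x)) (rearrange (g x) (g y) (g z))
    where
    rearrange : ∀ x y z → x + - (x + y + z) * 1ℤ ≡ - (y + z)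
    rearrange = solve-∀

  ext-old : ∀ {x y z} g {u} → x ≢ u → ext x y z g u ≡ g u
  ext-old {x} {y} {z} g {u} x≢u =
    trans (addˡ (g u) (trans (cong (- (g x + g y + g z) *_) (δ-≢ x≢u)) (ℤ.*-zeroʳ (- (g x + g y + g z)))))
          (ℤ.+-identityʳ (g u))

  OnEdges : List Edge → (Vertex → Vertex → Set) → Set
  OnEdges es R = ∀ {e} → e ∈ es → R (tail e) (head e)

  at-ends : ∀ {e u v} {R : Vertex → Vertex → Set} → (∀ {u v} → R u v → R v u) → Joins e u v →
            R u v → R (tail e) (head e)
  at-ends {R = R} sym-R (inj₁ eq) r = subst (λ p → R (proj₁ p) (proj₂ p)) (sym eq) r
  at-ends {R = R} sym-R (inj₂ eq) r = subst (λ p → R (proj₁ p) (proj₂ p)) (sym eq) (sym-R r)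

  from-ends : ∀ {e u v} {R : Vertex → Vertex → Set} → (∀ {u v} → R u v → R v u) → Joins e u v →
              R (tail e) (head e) → R u v
  from-ends {R = R} sym-R (inj₁ eq) r = subst (λ p → R (proj₁ p) (proj₂ p)) eq r
  from-ends {R = R} sym-R (inj₂ eq) r = sym-R (subst (λ p → R (proj₁ p) (proj₂ p)) eq r)

  extend-edges : ∀ {es x y z b c} {R : Vertex → Vertex → Set} → (∀ {u v} → R u v → R v u) →
                 Joins b x y → Joins c x z → R x y → R x z → OnEdges es R → OnEdges (b ∷ c ∷ es) R
  extend-edges {R = R} sym-R jb jc rxy rxz old (here refl)           = at-ends {R = R} sym-R jb rxy
  extend-edges {R = R} sym-R jb jc rxy rxz old (there (here refl))   = at-ends {R = R} sym-R jc rxz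
  extend-edges {R = R} sym-R jb jc rxy rxz old (there (there e∈es)) = old e∈es

  Trited : (Vertex → ℤ) → Vertex → Vertex → Set
  Trited χ u v = Adjacent (χ u) (χ v)

  module _ {vs es x y z a b c} (T : TwoTree vs es) (a∈es : a ∈ es) (ja : Joins a y z)
           (x∉vs : x ∉ vs) (jb : Joins b x y) (jc : Joins c x z) where

    old≢ : ∀ {u} → u ∈ vs → x ≢ u
    old≢ u∈vs refl = x∉vs u∈vs

    y∈vs : y ∈ vs
    y∈vs = proj₁ (joined∈ T a∈es ja)

    z∈vs : z ∈ vs
    z∈vs = proj₂ (joined∈ T a∈es ja)

    ext-end : ∀ g {u} → u ∈ vs → ext x y z g u ≡ g u
    ext-end g u∈vs = ext-old g (old≢ u∈vs)

  χ-edges : ∀ {vs es} (T : TwoTree vs es) → OnEdges es (Trited (χ T))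
  χ-edges (edge {y = y} {z} ja) (here refl) = at-ends {R = Trited (y ⇝ z)} adjacent-sym ja
    (subst₂ Adjacent
      (sym (cong₂ _-_ (δ-refl y) (δ-≢ (tail≢head ja ∘ sym))))
      (sym (cong₂ _-_ (δ-≢ (tail≢head ja)) (δ-refl z))) pm)
  χ-edges (add {x = x} {y} {z} T a∈es ja x∉vs jb jc) =
    extend-edges {R = Trited (ext x y z (χ T))} adjacent-sym jb jc
      (subst₂ Adjacent (sym (ext-new x y z (χ T))) (sym (old y∈)) (adjacent-third yz))
      (subst₂ Adjacent (trans (third-comm (χ T z) (χ T y)) (sym (ext-new x y z (χ T))))
                       (sym (old z∈)) (adjacent-third (adjacent-sym yz)))
      λ e∈es → subst₂ Adjacent (sym (old (proj₁ (ends∈ T e∈es)))) (sym (old (proj₂ (ends∈ T e∈es)))) (χ-edges T e∈es)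
    where
    old = ext-end T a∈es ja x∉vs jb jc (χ T)
    y∈ = y∈vs T a∈es ja x∉vs jb jc
    z∈ = z∈vs T a∈es ja x∉vs jb jc
    yz : Adjacent (χ T y) (χ T z)
    yz = from-ends {R = Trited (χ T)} adjacent-sym ja (χ-edges T a∈es)

  χ-joined : ∀ {vs es a y z} (T : TwoTree vs es) → a ∈ es → Joins a y z → Adjacent (χ T y) (χ T z)
  χ-joined T a∈es ja = from-ends {R = Trited (χ T)} adjacent-sym ja (χ-edges T a∈es)

  χ-trit : ∀ {vs es u} (T : TwoTree vs es) → u ∈ vs → Trit (χ T u)
  χ-trit T@(edge ja) (here refl)         = adjacent-trit (χ-joined T (here refl) ja)
  χ-trit T@(edge ja) (there (here refl)) = adjacent-trit (adjacent-sym (χ-joined T (here refl) ja))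
  χ-trit T@(add _ _ _ _ jb _) (here refl) = adjacent-trit (χ-joined T (here refl) jb)
  χ-trit (add T a∈es ja x∉vs jb jc) (there u∈vs) =
    subst Trit (sym (ext-end T a∈es ja x∉vs jb jc (χ T) u∈vs)) (χ-trit T u∈vs)

  -- This makes g u − g v equal to 0 or ±1 over ℤ, not only modulo 3, when u and v have the same colour.
  record Graded {vs es} (T : TwoTree vs es) (g : Vertex → ℤ) : Set where
    field
      σ      : ℤ → ℤ
      units  : ∀ i → Unit (σ i)
      values : ∀ {u} → u ∈ vs → g u ∈₀ σ (χ T u)
      thirds : OnEdges es λ u v → third (g u) (g v) ∈₀ σ (third (χ T u) (χ T v))

  thirds-sym : (σ : ℤ → ℤ) (χ g : Vertex → ℤ) → ∀ {u v} →
               third (g u) (g v) ∈₀ σ (third (χ u) (χ v)) → third (g v) (g u) ∈₀ σ (third (χ v) (χ u))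
  thirds-sym σ χ g {u} {v} = subst₂ (λ i j → i ∈₀ σ j) (third-comm (g u) (g v)) (third-comm (χ u) (χ v))

  module _ {vs es x y z a b c} (T : TwoTree vs es) (a∈es : a ∈ es) (ja : Joins a y z)
           (x∉vs : x ∉ vs) (jb : Joins b x y) (jc : Joins c x z) where
    private
      T′ = add T a∈es ja x∉vs jb jc
      y∈ = y∈vs T a∈es ja x∉vs jb jc
      z∈ = z∈vs T a∈es ja x∉vs jb jc
      old : ∀ g {u} → u ∈ vs → ext x y z g u ≡ g u
      old = ext-end T a∈es ja x∉vs jb jc
      third-y : ∀ g → third (ext x y z g x) (ext x y z g y) ≡ g z
      third-y g = trans (cong₂ third (ext-new x y z g) (old g y∈)) (third-third (g y) (g z))
      third-z : ∀ g → third (ext x y z g x) (ext x y z g z) ≡ g y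
      third-z g =
        trans (cong₂ third (trans (ext-new x y z g) (third-comm (g y) (g z))) (old g z∈)) (third-third (g z) (g y))

    -- `values` and `thirds` swap roles: the value at `x` is the third value over `yz`, while the
    -- third values over `xy` and `xz` are the old values at `z` and `y`.
    graded-ext : ∀ {g} → Graded T g → Graded T′ (ext x y z g)
    graded-ext {g} graded = record
      { σ = σ
      ; units = units
      ; values = λ { (here refl) → subst₂ (λ i j → i ∈₀ σ j) (sym (ext-new x y z g)) (sym (ext-new x y z (χ T)))
                                     (from-ends {R = λ u v → third (g u) (g v) ∈₀ σ (third (χ T u) (χ T v))}
                                       (λ {u} {v} → thirds-sym σ (χ T) g {u} {v}) ja (thirds a∈es))
                   ; (there u∈vs) → subst₂ (λ i j → i ∈₀ σ j) (sym (old g u∈vs)) (sym (old (χ T) u∈vs)) (values u∈vs) }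
      ; thirds = extend-edges {R = λ u v → third (g′ u) (g′ v) ∈₀ σ (third (χ T′ u) (χ T′ v))}
                   (λ {u} {v} → thirds-sym σ (χ T′) g′ {u} {v}) jb jc
                   (subst₂ (λ i j → i ∈₀ σ j) (sym (third-y g)) (sym (third-y (χ T))) (values z∈))
                   (subst₂ (λ i j → i ∈₀ σ j) (sym (third-z g)) (sym (third-z (χ T))) (values y∈))
                   λ e∈es → let t∈ , h∈ = ends∈ T e∈es in
                     subst₂ (λ i j → i ∈₀ σ j) (sym (cong₂ third (old g t∈) (old g h∈)))
                       (sym (cong₂ third (old (χ T) t∈) (old (χ T) h∈))) (thirds e∈es)
      }
      where
      open Graded graded
      g′ = ext x y z g

    -- `σ` is 1 on the colour of `x` and -1 on the other two. Beyond `xy` or `xz` the third value is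
    -- -1, and the third colour is that of `z` or `y`, hence not that of `x`.
    graded-new : Graded T′ (δ x)
    graded-new = record
      { σ = σ
      ; units = units
      ; values = λ { (here refl) → inj₂ (trans (δ-refl x) (sym σ-x))
                   ; (there u∈vs) → inj₁ (δ-≢ (old≢ T a∈es ja x∉vs jb jc u∈vs)) }
      ; thirds = extend-edges {R = λ u v → third (δ x u) (δ x v) ∈₀ σ (third (χ T′ u) (χ T′ v))}
                   (λ {u} {v} → thirds-sym σ (χ T′) (δ x) {u} {v}) jb jc
                   (inj₂ (trans (cong₂ third (δ-refl x) (δ-≢ (tail≢head jb)))
                     (sym (trans (cong σ (third-y (χ T))) (σ-≢ (χ T z)
                       (subst (χ T z ≢_) (trans (third-comm (χ T z) (χ T y)) (sym (ext-new x y z (χ T))))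
                         (adjacent-≢ (adjacent-sym (adjacent-third (adjacent-sym yz))))))))))
                   (inj₂ (trans (cong₂ third (δ-refl x) (δ-≢ (tail≢head jc)))
                     (sym (trans (cong σ (third-z (χ T))) (σ-≢ (χ T y)
                       (subst (χ T y ≢_) (sym (ext-new x y z (χ T))) (adjacent-≢ (adjacent-sym (adjacent-third yz)))))))))
                   λ e∈es → let t∈ , h∈ = ends∈ T e∈es in
                     inj₁ (cong₂ third (δ-≢ (old≢ T a∈es ja x∉vs jb jc t∈)) (δ-≢ (old≢ T a∈es ja x∉vs jb jc h∈)))
      }
      where
      yz = χ-joined T a∈es ja
      σ : ℤ → ℤ
      σ i with i ℤ.≟ χ T′ x
      ... | yes _ = 1ℤ
      ... | no  _ = -1ℤ
      units : ∀ i → Unit (σ i)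
      units i with i ℤ.≟ χ T′ x
      ... | yes _ = +1u
      ... | no  _ = -1u
      σ-x : σ (χ T′ x) ≡ 1ℤ
      σ-x with χ T′ x ℤ.≟ χ T′ x
      ... | yes _ = refl
      ... | no  p = ⊥-elim (p refl)
      σ-≢ : ∀ i → i ≢ χ T′ x → σ i ≡ -1ℤ
      σ-≢ i i≢ with i ℤ.≟ χ T′ x
      ... | yes p = ⊥-elim (i≢ p)
      ... | no  _ = refl

  basis-graded : ∀ {vs es} (T : TwoTree vs es) → All (λ tg → Graded T (proj₂ tg)) (basis T)
  basis-graded (edge _) = []
  basis-graded (add T a∈es ja x∉vs jb jc) =
    graded-new T a∈es ja x∉vs jb jc ∷ All.map⁺ (All.map (graded-ext T a∈es ja x∉vs jb jc) (basis-graded T))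

  -- The w-coordinate of Σ_t g_t(u) t − u, which turns out to depend only on the colour of u.
  defect : ∀ {vs es} → TwoTree vs es → Vertex → Vertex → ℤ
  defect T w u = (∑[ tg ← basis T ] (proj₁ tg w * proj₂ tg u)) - δ u w

  -- On the three colours this says that the values of `b` sum to 0, the law that `ext` imposes on a
  -- new triangle.
  record Balanced (b : ℤ → ℤ) : Set where
    constructor balance
    field third-value : ∀ {i j} → Adjacent i j → b (third i j) ≡ third (b i) (b j)
  open Balanced

  -- The last clause is meant for colour 0; integers that are not colours share its value.
  base-values : ℤ → ℤ → ℤ → ℤ
  base-values p q (+ 1)    = p
  base-values p q -[1+ 0 ] = q
  base-values p q _        = third p q

  base-balanced : ∀ p q → Balanced (base-values p q)
  base-balanced p q = balance λ
    { pz → sym (trans (third-comm p (third p q)) (third-third p q))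
    ; zp → sym (third-third p q)
    ; pm → refl
    ; mp → third-comm p q
    ; zm → sym (trans (cong (λ i → third i q) (third-comm p q)) (third-third q p))
    ; mz → sym (trans (third-comm q (third p q)) (trans (cong (λ i → third i q) (third-comm p q)) (third-third q p))) }

  -- At a new vertex `x` its triangle contributes `δ x w + δ y w + δ z w`, and subtracting `δ x w`
  -- leaves exactly what makes the defect at `x` the `third` of those at `y` and `z`. The colour of
  -- `x` arises by the same rule, so one `b` serves all steps.
  defect-coloured : ∀ {vs es} (T : TwoTree vs es) w →
                    ∃ λ b → Balanced b × (∀ {u} → u ∈ vs → defect T w u ≡ b (χ T u))
  defect-coloured (edge {y = y} {z} ja) w =
    base-values (0ℤ - δ y w) (0ℤ - δ z w) , base-balanced _ _ , at
    where
    at : ∀ {u} → u ∈ y ∷ z ∷ [] → 0ℤ - δ u w ≡ base-values (0ℤ - δ y w) (0ℤ - δ z w) ((y ⇝ z) u)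
    at (here refl)         = sym (cong (base-values (0ℤ - δ y w) (0ℤ - δ z w))
                                   (cong₂ _-_ (δ-refl y) (δ-≢ (tail≢head ja ∘ sym))))
    at (there (here refl)) = sym (cong (base-values (0ℤ - δ y w) (0ℤ - δ z w))
                                   (cong₂ _-_ (δ-≢ (tail≢head ja)) (δ-refl z)))
  defect-coloured (add {vs = vs} {x = x} {y} {z} T a∈es ja x∉vs jb jc) w with defect-coloured T w
  ... | b , bal , at = b , bal , at′
    where
    T′ = add T a∈es ja x∉vs jb jc
    old : ∀ g {u} → u ∈ vs → ext x y z g u ≡ g u
    old = ext-end T a∈es ja x∉vs jb jc
    y∈ = y∈vs T a∈es ja x∉vs jb jc
    z∈ = z∈vs T a∈es ja x∉vs jb jc
    sum-map : ∀ u → ∑ (map (map₂ (ext x y z)) (basis T)) (λ tg → proj₁ tg w * proj₂ tg u)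
                      ≡ ∑[ tg ← basis T ] (proj₁ tg w * ext x y z (proj₂ tg) u)
    sum-map u = ∑-map (map₂ (ext x y z)) (basis T) (λ tg → proj₁ tg w * proj₂ tg u)
    s : Vertex → ℤ
    s u = ∑[ tg ← basis T ] (proj₁ tg w * proj₂ tg u)
    sum-new : ∑[ tg ← basis T ] (proj₁ tg w * ext x y z (proj₂ tg) x) ≡ -1ℤ * s y + -1ℤ * s z
    sum-new = begin
      ∑[ tg ← basis T ] (proj₁ tg w * ext x y z (proj₂ tg) x)
        ≡⟨ ∑-≗ (basis T) (λ tg → trans (cong (proj₁ tg w *_) (ext-new x y z (proj₂ tg)))
                                       (rearrange (proj₁ tg w) (proj₂ tg y) (proj₂ tg z))) ⟩
      ∑[ tg ← basis T ] (-1ℤ * (proj₁ tg w * proj₂ tg y) + -1ℤ * (proj₁ tg w * proj₂ tg z))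
        ≡⟨ ∑-+ (basis T) (λ tg → -1ℤ * (proj₁ tg w * proj₂ tg y)) (λ tg → -1ℤ * (proj₁ tg w * proj₂ tg z)) ⟩
      (∑[ tg ← basis T ] (-1ℤ * (proj₁ tg w * proj₂ tg y))) + (∑[ tg ← basis T ] (-1ℤ * (proj₁ tg w * proj₂ tg z)))
        ≡⟨ cong₂ _+_ (∑-* (basis T) -1ℤ (λ tg → proj₁ tg w * proj₂ tg y))
                     (∑-* (basis T) -1ℤ (λ tg → proj₁ tg w * proj₂ tg z)) ⟩
      -1ℤ * s y + -1ℤ * s z ∎
      where
      open ≡-Reasoning
      rearrange : ∀ t y z → t * - (y + z) ≡ -1ℤ * (t * y) + -1ℤ * (t * z)
      rearrange = solve-∀
    at′ : ∀ {u} → u ∈ x ∷ vs → defect T′ w u ≡ b (χ T′ u)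
    at′ {u} (there u∈vs) = begin
      triangle-at x y z w * δ x u + ∑ (map (map₂ (ext x y z)) (basis T)) (λ tg → proj₁ tg w * proj₂ tg u) - δ u w
        ≡⟨ cong₂ (λ i j → triangle-at x y z w * i + j - δ u w) (δ-≢ (old≢ T a∈es ja x∉vs jb jc u∈vs))
             (trans (sum-map u) (∑-≗ (basis T) λ tg → cong (proj₁ tg w *_) (old (proj₂ tg) u∈vs))) ⟩
      triangle-at x y z w * 0ℤ + s u - δ u w
        ≡⟨ rearrange (triangle-at x y z w) (s u) (δ u w) ⟩
      defect T w u
        ≡⟨ trans (at u∈vs) (cong b (sym (old (χ T) u∈vs))) ⟩
      b (χ T′ u) ∎
      where
      open ≡-Reasoning
      rearrange : ∀ t s d → t * 0ℤ + s - d ≡ s - d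
      rearrange = solve-∀
    at′ (here refl) = begin
      triangle-at x y z w * δ x x + ∑ (map (map₂ (ext x y z)) (basis T)) (λ tg → proj₁ tg w * proj₂ tg x) - δ x w
        ≡⟨ cong₂ (λ i j → triangle-at x y z w * i + j - δ x w) (δ-refl x) (trans (sum-map x) sum-new) ⟩
      triangle-at x y z w * 1ℤ + (-1ℤ * s y + -1ℤ * s z) - δ x w
        ≡⟨ rearrange (δ x w) (δ y w) (δ z w) (s y) (s z) ⟩
      third (defect T w y) (defect T w z)
        ≡⟨ cong₂ third (at y∈) (at z∈) ⟩
      third (b (χ T y)) (b (χ T z))
        ≡⟨ third-value bal (χ-joined T a∈es ja) ⟨
      b (third (χ T y) (χ T z))
        ≡⟨ cong b (ext-new x y z (χ T)) ⟨
      b (χ T′ x) ∎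
      where
      open ≡-Reasoning
      rearrange : ∀ x y z p q → (x + y + z) * 1ℤ + (-1ℤ * p + -1ℤ * q) - x ≡ - ((p - y) + (q - z))
      rearrange = solve-∀

  -- Equal colours give equal defects, which cancel in the difference.
  expand : ∀ {vs es} (T : TwoTree vs es) w {u v} → u ∈ vs → v ∈ vs → χ T u ≡ χ T v →
           δ u w - δ v w ≡ ∑[ tg ← basis T ] (proj₁ tg w * (proj₂ tg u - proj₂ tg v))
  expand T w {u} {v} u∈vs v∈vs χ≡ with defect-coloured T w
  ... | b , _ , at = begin
    δ u w - δ v w
      ≡⟨ rearrange (s u) (s v) (δ u w) (δ v w) ⟩
    (s u - s v) - (defect T w u - defect T w v)
      ≡⟨ cong (λ i → (s u - s v) - i) (ℤ.i≡j⇒i-j≡0 {defect T w u} {defect T w v}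
           (trans (at u∈vs) (trans (cong b χ≡) (sym (at v∈vs))))) ⟩
    (s u - s v) - 0ℤ
      ≡⟨ trans (ℤ.+-identityʳ (s u - s v)) (addˡ (s u) (sym (ℤ.-1*i≡-i (s v)))) ⟩
    s u + -1ℤ * s v
      ≡⟨ addˡ (s u) (sym (∑-* (basis T) -1ℤ (λ tg → proj₁ tg w * proj₂ tg v))) ⟩
    s u + (∑[ tg ← basis T ] (-1ℤ * (proj₁ tg w * proj₂ tg v)))
      ≡⟨ ∑-+ (basis T) (λ tg → proj₁ tg w * proj₂ tg u) (λ tg → -1ℤ * (proj₁ tg w * proj₂ tg v)) ⟨
    ∑[ tg ← basis T ] (proj₁ tg w * proj₂ tg u + -1ℤ * (proj₁ tg w * proj₂ tg v))
      ≡⟨ ∑-≗ (basis T) (λ tg → collect (proj₁ tg w) (proj₂ tg u) (proj₂ tg v)) ⟩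
    ∑[ tg ← basis T ] (proj₁ tg w * (proj₂ tg u - proj₂ tg v)) ∎
    where
    open ≡-Reasoning
    s : Vertex → ℤ
    s u = ∑[ tg ← basis T ] (proj₁ tg w * proj₂ tg u)
    rearrange : ∀ s t d e → d - e ≡ (s - t) - ((s - d) - (t - e))
    rearrange = solve-∀
    collect : ∀ t a b → t * a + -1ℤ * (t * b) ≡ t * (a - b)
    collect = solve-∀

  ∈₀-difference : ∀ {s x y} → Unit s → x ∈₀ s → y ∈₀ s → Trit (x - y)
  ∈₀-difference _   (inj₁ refl) (inj₁ refl) = t0
  ∈₀-difference +1u (inj₁ refl) (inj₂ refl) = t-
  ∈₀-difference -1u (inj₁ refl) (inj₂ refl) = t+
  ∈₀-difference +1u (inj₂ refl) (inj₁ refl) = t+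
  ∈₀-difference -1u (inj₂ refl) (inj₁ refl) = t-
  ∈₀-difference +1u (inj₂ refl) (inj₂ refl) = t0
  ∈₀-difference -1u (inj₂ refl) (inj₂ refl) = t0

  graded-slope : ∀ {vs es g u v} (T : TwoTree vs es) → Graded T g → u ∈ vs → v ∈ vs → χ T u ≡ χ T v →
                 Trit (g u - g v)
  graded-slope {g = g} {v = v} T graded u∈vs v∈vs χ≡ =
    ∈₀-difference (units (χ T _)) (values u∈vs) (subst (λ i → g v ∈₀ σ i) (sym χ≡) (values v∈vs))
    where open Graded graded

  -- Triangles at a vertex, and degrees within the tree.

  triangles-at : ∀ {vs es} → TwoTree vs es → Vertex → ℤ
  triangles-at T w = ∑[ tg ← basis T ] proj₁ tg w

  triangles-at-add : ∀ {vs es x y z a b c} (T : TwoTree vs es) (a∈es : a ∈ es) (ja : Joins a y z)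
                     (x∉vs : x ∉ vs) (jb : Joins b x y) (jc : Joins c x z) w →
                     triangles-at (add T a∈es ja x∉vs jb jc) w ≡ triangle-at x y z w + triangles-at T w
  triangles-at-add {x = x} {y} {z} T _ _ _ _ _ w =
    addˡ (triangle-at x y z w) (∑-map (map₂ (ext x y z)) (basis T) (λ tg → proj₁ tg w))

  0≤δ : ∀ (u v : Vertex) → 0ℤ ≤ δ u v
  0≤δ u v with u ≟ v
  ... | yes _ = +≤+ ℕ.z≤n
  ... | no  _ = ℤ.≤-refl

  0≤triangle : ∀ x y z w → 0ℤ ≤ triangle-at x y z w
  0≤triangle x y z w = ℤ.+-mono-≤ (ℤ.+-mono-≤ (0≤δ x w) (0≤δ y w)) (0≤δ z w)

  1≤triangle : ∀ {x y z w} → w ∈ x ∷ y ∷ z ∷ [] → 1ℤ ≤ triangle-at x y z w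
  1≤triangle {x} {y} {z} (here refl) =
    ℤ.+-mono-≤ (ℤ.+-mono-≤ (ℤ.≤-reflexive (sym (δ-refl x))) (0≤δ y x)) (0≤δ z x)
  1≤triangle {x} {y} {z} (there (here refl)) =
    ℤ.+-mono-≤ (ℤ.+-mono-≤ (0≤δ x y) (ℤ.≤-reflexive (sym (δ-refl y)))) (0≤δ z y)
  1≤triangle {x} {y} {z} (there (there (here refl))) =
    ℤ.+-mono-≤ (ℤ.+-mono-≤ (0≤δ x z) (0≤δ y z)) (ℤ.≤-reflexive (sym (δ-refl z)))

  0≤triangles-at : ∀ {vs es} (T : TwoTree vs es) w → 0ℤ ≤ triangles-at T w
  0≤triangles-at (edge _) w = ℤ.≤-refl
  0≤triangles-at (add {x = x} {y} {z} T a∈es ja x∉vs jb jc) w =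
    subst (0ℤ ≤_) (sym (triangles-at-add T a∈es ja x∉vs jb jc w))
      (ℤ.+-mono-≤ (0≤triangle x y z w) (0≤triangles-at T w))

  -- A lone edge violates this, so it is recorded beside `TwoTree`; it yields degree at least 2
  -- within the tree.
  Covered : ∀ {vs es} → TwoTree vs es → Set
  Covered {vs} T = ∀ {v} → v ∈ vs → 1ℤ ≤ triangles-at T v

  record Presentation (V : Subset order) (E : Subset size) : Set where
    field
      {vs}    : List Vertex
      {es}    : List Edge
      tree    : TwoTree vs es
      covered : Covered tree
      V⇒vs    : ∀ {v} → v Subset.∈ V → v ∈ vs
      vs⇒V    : ∀ {v} → v ∈ vs → v Subset.∈ V
      E⇒es    : ∀ {e} → e Subset.∈ E → e ∈ es

  ∈∪⇒∈∷ : ∀ {n} {x : Fin n} {S xs} → (∀ {v} → v Subset.∈ S → v ∈ xs) → ∀ {v} → v Subset.∈ ⁅ x ⁆ ∪ S → v ∈ x ∷ xs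
  ∈∪⇒∈∷ {x = x} {S} S⇒xs v∈ with Subset.x∈p∪q⁻ ⁅ x ⁆ S v∈
  ... | inj₁ v∈x = here (Subset.x∈⁅y⁆⇒x≡y x v∈x)
  ... | inj₂ v∈S = there (S⇒xs v∈S)

  ∈∷⇒∈∪ : ∀ {n} {x : Fin n} {S xs} → (∀ {v} → v ∈ xs → v Subset.∈ S) → ∀ {v} → v ∈ x ∷ xs → v Subset.∈ ⁅ x ⁆ ∪ S
  ∈∷⇒∈∪ xs⇒S (here refl)  = Subset.x∈p∪q⁺ (inj₁ (Subset.x∈⁅x⁆ _))
  ∈∷⇒∈∪ xs⇒S (there v∈xs) = Subset.x∈p∪q⁺ (inj₂ (xs⇒S v∈xs))

  singleton⇒ : ∀ {n} {x v : Fin n} → v Subset.∈ ⁅ x ⁆ → v ∈ x ∷ []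
  singleton⇒ {x = x} v∈ = here (Subset.x∈⁅y⁆⇒x≡y x v∈)

  ⇒singleton : ∀ {n} {x v : Fin n} → v ∈ x ∷ [] → v Subset.∈ ⁅ x ⁆
  ⇒singleton (here refl) = Subset.x∈⁅x⁆ _

  present : ∀ {V E} → TriangleTree G V E → Presentation V E
  present (triangle {x} {y} {z} {a} {b} {c} ja jb jc) = record
    { tree    = tree
    ; covered = λ {v} v∈ → ℤ.≤-trans (1≤triangle v∈) (ℤ.≤-reflexive
                  (sym (trans (triangles-at-add (edge jb) (here refl) jb x∉ ja jc v)
                              (ℤ.+-identityʳ (triangle-at x y z v)))))
    ; V⇒vs    = ∈∪⇒∈∷ (∈∪⇒∈∷ singleton⇒)
    ; vs⇒V    = ∈∷⇒∈∪ (∈∷⇒∈∪ ⇒singleton)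
    -- The triangle is presented with `b` as its first edge and `x` attached by `a` and `c`, which
    -- changes the order of the edges.
    ; E⇒es    = λ e∈ → swap (∈∪⇒∈∷ (∈∪⇒∈∷ singleton⇒) e∈)
    }
    where
    x∉ : x ∉ y ∷ z ∷ []
    x∉ (here x≡y)         = tail≢head ja x≡y
    x∉ (there (here x≡z)) = tail≢head jc x≡z
    tree = add (edge jb) (here refl) jb x∉ ja jc
    swap : ∀ {e} → e ∈ a ∷ b ∷ c ∷ [] → e ∈ a ∷ c ∷ b ∷ []
    swap (here p)                 = here p
    swap (there (here p))         = there (there (here p))
    swap (there (there (here p))) = there (here p)
  present (addVertex {x = x} {y} {z} T a∈E ja x∉V jb jc) = record
    { tree    = add tree (E⇒es a∈E) ja (x∉V ∘ vs⇒V) jb jc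
    ; covered = λ {v} v∈ → subst (1ℤ ≤_) (sym (triangles-at-add tree (E⇒es a∈E) ja (x∉V ∘ vs⇒V) jb jc v)) (bound v∈)
    ; V⇒vs    = ∈∪⇒∈∷ V⇒vs
    ; vs⇒V    = ∈∷⇒∈∪ vs⇒V
    ; E⇒es    = ∈∪⇒∈∷ (∈∪⇒∈∷ E⇒es)
    }
    where
    open Presentation (present T)
    bound : ∀ {v} → v ∈ x ∷ vs → 1ℤ ≤ triangle-at x y z v + triangles-at tree v
    bound (here refl)      = ℤ.+-mono-≤ (1≤triangle {x} {y} {z} (here refl)) (0≤triangles-at tree x)
    bound (there {v} v∈vs) = ℤ.+-mono-≤ (0≤triangle x y z _) (covered v∈vs)

  vertex-count : ∀ {vs es} (T : TwoTree vs es) → length vs ≡ 2 ℕ.+ length (basis T)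
  vertex-count (edge _) = refl
  vertex-count (add {x = x} {y} {z} T _ _ _ _ _) =
    cong suc (trans (vertex-count T) (cong (λ k → 2 ℕ.+ k) (sym (length-map (map₂ (ext x y z)) (basis T)))))

  ⇝² : ∀ {u v : Vertex} → u ≢ v → ∀ w → (u ⇝ v) w * (u ⇝ v) w ≡ δ u w + δ v w
  ⇝² {u} {v} u≢v w with u ≟ w | v ≟ w
  ... | yes refl | yes refl = ⊥-elim (u≢v refl)
  ... | yes _    | no  _    = refl
  ... | no  _    | yes _    = refl
  ... | no  _    | no  _    = refl

  inc² : ∀ {e u v} → Joins e u v → ∀ w → inc e w * inc e w ≡ δ u w + δ v w
  inc² {u = u} {v} j w with joins-inc j
  ... | inj₁ eq = trans (cong (λ i → i * i) (eq w)) (⇝² (tail≢head j) w)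
  ... | inj₂ eq = trans (cong (λ i → i * i) (eq w)) (trans (neg*neg ((u ⇝ v) w) ((u ⇝ v) w)) (⇝² (tail≢head j) w))

  -- An `add` raises degree and triangle count of `y` and `z` by 1 each, while `x` enters with
  -- degree 2 and one triangle; `count` is the constant surplus of 1.
  tree-degree : ∀ {vs es} (T : TwoTree vs es) w →
                ∑[ e ← es ] (inc e w * inc e w) ≡ triangles-at T w + count vs w
  tree-degree (edge {a} {y} {z} ja) w = trans (ℤ.+-identityʳ (inc a w * inc a w))
    (trans (inc² ja w) (rearrange (δ y w) (δ z w)))
    where
    rearrange : ∀ y z → y + z ≡ 0ℤ + (y + (z + 0ℤ))
    rearrange = solve-∀
  tree-degree (add {vs} {es} {x} {y} {z} {b = b} {c} T a∈es ja x∉vs jb jc) w = begin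
    inc b w * inc b w + (inc c w * inc c w + ∑ es (λ e → inc e w * inc e w))
      ≡⟨ cong₂ _+_ (inc² jb w) (cong₂ _+_ (inc² jc w) (tree-degree T w)) ⟩
    δ x w + δ y w + (δ x w + δ z w + (triangles-at T w + count vs w))
      ≡⟨ rearrange (δ x w) (δ y w) (δ z w) (triangles-at T w) (count vs w) ⟩
    triangle-at x y z w + triangles-at T w + (δ x w + count vs w)
      ≡⟨ cong (_+ (δ x w + count vs w)) (triangles-at-add T a∈es ja x∉vs jb jc w) ⟨
    triangles-at (add T a∈es ja x∉vs jb jc) w + (δ x w + count vs w) ∎
    where
    open ≡-Reasoning
    rearrange : ∀ x y z t c → x + y + (x + z + (t + c)) ≡ x + y + z + t + (x + c)
    rearrange = solve-∀

  ∑-δ1 : ∀ x → ∑ vertices (δ x) ≡ 1ℤ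
  ∑-δ1 x = trans (∑-≗ vertices λ v → sym (ℤ.*-identityʳ (δ x v))) (∑-δ x (λ _ → 1ℤ))

  ∑-triangle : ∀ x y z → ∑ vertices (triangle-at x y z) ≡ + 3
  ∑-triangle x y z = trans (∑-+ vertices (λ v → δ x v + δ y v) (δ z))
    (cong₂ _+_ (trans (∑-+ vertices (δ x) (δ y)) (cong₂ _+_ (∑-δ1 x) (∑-δ1 y))) (∑-δ1 z))

  basis-sums : ∀ {vs es} (T : TwoTree vs es) → All (λ tg → ∑ vertices (proj₁ tg) ≡ + 3) (basis T)
  basis-sums (edge _) = []
  basis-sums (add {x = x} {y} {z} T _ _ _ _ _) = ∑-triangle x y z ∷ All.map⁺ (basis-sums T)

  -- Signs outside a spanning tree, and the count of cubic vertices.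

  module Spanned {vs es} (T : TwoTree vs es) (covered : Covered T) (all∈ : ∀ v → v ∈ vs) where

    m : Edge → ℤ
    m = mask es

    q : (Vertex → ℤ) → Edge → ℤ
    q g e = m e * slope g e

    ⟨⟩-signed : ∀ g (ε : Edge → ℤ) → ⟨ g , ∂ (λ e → m e * ε e) ⟩ ≡ ∑[ e ← edges ] (q g e * ε e)
    ⟨⟩-signed g ε = trans (⟨⟩-∂ g (λ e → m e * ε e)) (∑-≗ edges λ e → rearrange (m e) (ε e) (slope g e))
      where
      rearrange : ∀ m ε s → m * ε * s ≡ m * s * ε
      rearrange = solve-∀

    Monochromatic : Edge → Set
    Monochromatic e = χ T (tail e) ≡ χ T (head e)

    -- Reversing the sign of `e` changes the pairing with the colouring by -2 times a nonzero
    -- difference of colours, which 3 does not divide. So the pairing is nonzero modulo 3 for one of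
    -- the two patterns.
    dichromatic⇒flow : ∀ e → e ∉ es → ¬ Monochromatic e → NowhereZero3Flow G
    dichromatic⇒flow e e∉es ¬mono with + 3 ∣? ⟨ χ T , ∂ (λ e′ → m e′ * 1ℤ) ⟩
    ... | no  3∤ = signs⇒flow T all∈ (λ _ → 1ℤ) (λ _ → +1u) (inj₂ 3∤)
    ... | yes 3∣ = signs⇒flow T all∈ ε units (inj₂ λ 3∣′ →
            ∤-doubled-difference (χ-trit T (all∈ _)) (χ-trit T (all∈ _)) ¬mono
              (subst (+ 3 ∣_) (trans (cong (_- p) pairing) (cancel p (- (+ 2) * slope (χ T) e))) (∣m∣n⇒∣m-n 3∣′ 3∣)))
      where
      p = ⟨ χ T , ∂ (λ e′ → m e′ * 1ℤ) ⟩
      ε : Edge → ℤ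
      ε = override e -1ℤ (λ _ → 1ℤ)
      units : ∀ e′ → Unit (ε e′)
      units = override-units e -1u (λ _ → +1u)
      changed : ∀ e′ → m e′ * ε e′ ≡ m e′ * 1ℤ + - (+ 2) * δ e e′
      changed e′ with e ≟ e′
      ... | yes refl rewrite mask-∉ e∉es = refl
      ... | no  _    = sym (ℤ.+-identityʳ (m e′ * 1ℤ))
      pairing : ⟨ χ T , ∂ (λ e′ → m e′ * ε e′) ⟩ ≡ p + - (+ 2) * slope (χ T) e
      pairing = begin
        ⟨ χ T , ∂ (λ e′ → m e′ * ε e′) ⟩
          ≡⟨ ⟨⟩-cong (χ T) (λ v → trans (∑-≗ edges λ e′ → cong (_* inc e′ v) (changed e′))
                                           (∂-+δ (λ e′ → m e′ * 1ℤ) e (- (+ 2)) v)) ⟩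
        ⟨ χ T , (λ v → ∂ (λ e′ → m e′ * 1ℤ) v + - (+ 2) * inc e v) ⟩
          ≡⟨ ⟨⟩-+ (χ T) (∂ (λ e′ → m e′ * 1ℤ)) (λ v → - (+ 2) * inc e v) ⟩
        p + ⟨ χ T , (λ v → - (+ 2) * inc e v) ⟩
          ≡⟨ addˡ p (trans (⟨⟩-* (χ T) (- (+ 2)) (inc e)) (cong (- (+ 2) *_) (⟨⟩-inc (χ T) e))) ⟩
        p + - (+ 2) * slope (χ T) e ∎
        where open ≡-Reasoning
      cancel : ∀ p s → p + s - p ≡ s
      cancel = solve-∀

    module _ (mono : ∀ e → e ∉ es → Monochromatic e) where

      q-trit : ∀ {tg} → tg ∈ basis T → ∀ e → Trit (q (proj₂ tg) e)
      q-trit {t , g} tg∈ e with e ∈? es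
      ... | yes e∈es rewrite mask-∈ (unique-edges T) e∈es = t0
      ... | no  e∉es rewrite mask-∉ e∉es = subst Trit (sym (ℤ.*-identityˡ (slope g e)))
              (graded-slope T (All.lookup (basis-graded T) tg∈) (all∈ _) (all∈ _) (mono e e∉es))

      -- Sum 1 of the squares encodes that exactly one coefficient is nonzero; in the other two
      -- cases of `signing` some signs bring the pairing to 0 modulo 3.
      flow-or-one : ∀ {tg} → tg ∈ basis T →
                    NowhereZero3Flow G ⊎ ∑[ e ← edges ] (q (proj₂ tg) e * q (proj₂ tg) e) ≡ 1ℤ
      flow-or-one {t , g} tg∈ with signing edges (allFin⁺ size) (q g) (q-trit tg∈)
      ... | vanishing zeros = inj₁ (signs⇒flow T all∈ (λ _ → 1ℤ) (λ _ → +1u) (inj₁ (lose tg∈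
              (divides 0ℤ (trans (⟨⟩-signed g (λ _ → 1ℤ))
                          (trans (∑-cong edges λ e∈ → cong (_* 1ℤ) (zeros e∈)) (∑-zero edges)))))))
      ... | single sq _ = inj₂ sq
      ... | universal hits = let ε , units , d = hits 0ℤ in inj₁ (signs⇒flow T all∈ ε units (inj₁ (lose tg∈
              (subst (+ 3 ∣_) (trans (flip-sign (∑[ e ← edges ] (q g e * ε e))) (sym (⟨⟩-signed g ε))) (∣m⇒∣-m d)))))
        where
        flip-sign : ∀ s → - (0ℤ - s) ≡ s
        flip-sign = solve-∀

      module _ (ones : All (λ tg → ∑[ e ← edges ] (q (proj₂ tg) e * q (proj₂ tg) e) ≡ 1ℤ) (basis T)) where

        τ : Vertex → ℤ
        τ = triangles-at T

        k : ℤ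
        k = + length (basis T)

        m-inc : ∀ e w → m e * inc e w ≡ ∑[ tg ← basis T ] (proj₁ tg w * q (proj₂ tg) e)
        m-inc e w with e ∈? es
        ... | yes e∈es rewrite mask-∈ (unique-edges T) e∈es =
          sym (trans (∑-≗ (basis T) λ tg → ℤ.*-zeroʳ (proj₁ tg w)) (∑-zero (basis T)))
        ... | no  e∉es rewrite mask-∉ e∉es = begin
          1ℤ * inc e w   ≡⟨ ℤ.*-identityˡ (inc e w) ⟩
          inc e w        ≡⟨ expand T w (all∈ _) (all∈ _) (mono e e∉es) ⟩
          ∑[ tg ← basis T ] (proj₁ tg w * slope (proj₂ tg) e)
            ≡⟨ ∑-≗ (basis T) (λ tg → cong (proj₁ tg w *_) (sym (ℤ.*-identityˡ (slope (proj₂ tg) e)))) ⟩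
          ∑[ tg ← basis T ] (proj₁ tg w * (1ℤ * slope (proj₂ tg) e)) ∎
          where open ≡-Reasoning

        inc-trit : ∀ e w → Trit (inc e w)
        inc-trit e w with tail e ≟ w | head e ≟ w
        ... | yes _ | yes _ = t0
        ... | yes _ | no  _ = t+
        ... | no  _ | yes _ = t-
        ... | no  _ | no  _ = t0

        extra : Vertex → ℤ
        extra w = ∑[ e ← edges ] (m e * (inc e w * inc e w))

        -- Both brackets have the form x² - x with x in {0, 1, -1}, hence are even. Their linear
        -- terms cancel by `m-inc`, so only squares survive in `square-split`.
        even-part : Vertex → Edge → ℤ
        even-part w e = m e * (inc e w * inc e w - inc e w)
                          + -1ℤ * (∑[ tg ← basis T ] (proj₁ tg w * (q (proj₂ tg) e * q (proj₂ tg) e - q (proj₂ tg) e)))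

        even-part-even : ∀ w e → + 2 ∣ even-part w e
        even-part-even w e = ∣m∣n⇒∣m+n (∣n⇒∣m*n (m e) (trit-even (inc-trit e w)))
          (∣n⇒∣m*n -1ℤ (∑-∣ (basis T) λ {tg} tg∈ → ∣n⇒∣m*n (proj₁ tg w) (trit-even (q-trit tg∈ e))))

        square-split : ∀ w e → m e * (inc e w * inc e w)
                                 ≡ even-part w e + (∑[ tg ← basis T ] (proj₁ tg w * (q (proj₂ tg) e * q (proj₂ tg) e)))
        square-split w e = begin
          m e * (inc e w * inc e w)
            ≡⟨ rearrange (m e) (inc e w) S₂ S₁ ⟩
          m e * (inc e w * inc e w - inc e w) + -1ℤ * (S₂ - S₁) + S₂ + (m e * inc e w - S₁)
            ≡⟨ cong₂ (λ i j → m e * (inc e w * inc e w - inc e w) + -1ℤ * i + S₂ + j) (sym difference)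
                 (ℤ.i≡j⇒i-j≡0 {m e * inc e w} {S₁} (m-inc e w)) ⟩
          even-part w e + S₂ + 0ℤ
            ≡⟨ ℤ.+-identityʳ (even-part w e + S₂) ⟩
          even-part w e + S₂ ∎
          where
          open ≡-Reasoning
          S₁ = ∑[ tg ← basis T ] (proj₁ tg w * q (proj₂ tg) e)
          S₂ = ∑[ tg ← basis T ] (proj₁ tg w * (q (proj₂ tg) e * q (proj₂ tg) e))
          rearrange : ∀ m i s r → m * (i * i) ≡ m * (i * i - i) + -1ℤ * (s - r) + s + (m * i - r)
          rearrange = solve-∀
          distribute : ∀ t q → t * (q * q - q) ≡ t * (q * q) + -1ℤ * (t * q)
          distribute = solve-∀
          difference : ∑[ tg ← basis T ] (proj₁ tg w * (q (proj₂ tg) e * q (proj₂ tg) e - q (proj₂ tg) e)) ≡ S₂ - S₁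
          difference = trans (∑-≗ (basis T) λ tg → distribute (proj₁ tg w) (q (proj₂ tg) e))
            (trans (∑-+ (basis T) (λ tg → proj₁ tg w * (q (proj₂ tg) e * q (proj₂ tg) e))
                                (λ tg → -1ℤ * (proj₁ tg w * q (proj₂ tg) e)))
              (addˡ S₂ (trans (∑-* (basis T) -1ℤ (λ tg → proj₁ tg w * q (proj₂ tg) e)) (ℤ.-1*i≡-i S₁))))

        -- Summing over edges first, the squares of each triangle's coefficients total 1, so each
        -- triangle at `w` counts once.
        extra-parity : ∀ w → extra w ≡ ∑ edges (even-part w) + τ w
        extra-parity w = begin
          extra w
            ≡⟨ ∑-≗ edges (square-split w) ⟩
          ∑[ e ← edges ] (even-part w e + (∑[ tg ← basis T ] (proj₁ tg w * (q (proj₂ tg) e * q (proj₂ tg) e))))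
            ≡⟨ ∑-+ edges (even-part w) (λ e → ∑[ tg ← basis T ] (proj₁ tg w * (q (proj₂ tg) e * q (proj₂ tg) e))) ⟩
          ∑ edges (even-part w) + (∑[ e ← edges ] ∑[ tg ← basis T ] (proj₁ tg w * (q (proj₂ tg) e * q (proj₂ tg) e)))
            ≡⟨ addˡ (∑ edges (even-part w))
                  (∑-swap edges (basis T) (λ e tg → proj₁ tg w * (q (proj₂ tg) e * q (proj₂ tg) e))) ⟩
          ∑ edges (even-part w) + (∑[ tg ← basis T ] ∑[ e ← edges ] (proj₁ tg w * (q (proj₂ tg) e * q (proj₂ tg) e)))
            ≡⟨ addˡ (∑ edges (even-part w)) (∑-cong (basis T) λ {tg} tg∈ →
                 trans (∑-* edges (proj₁ tg w) (λ e → q (proj₂ tg) e * q (proj₂ tg) e))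
                   (trans (cong (proj₁ tg w *_) (All.lookup ones tg∈)) (ℤ.*-identityʳ (proj₁ tg w)))) ⟩
          ∑ edges (even-part w) + τ w ∎
          where open ≡-Reasoning

        deg : Vertex → ℤ
        deg w = ∑[ e ← edges ] (inc e w * inc e w)

        deg-split : ∀ w → deg w ≡ τ w + 1ℤ + extra w
        deg-split w = begin
          deg w
            ≡⟨ ∑-≗ edges (λ e → rearrange (count es e) (inc e w * inc e w)) ⟩
          ∑[ e ← edges ] (count es e * (inc e w * inc e w) + m e * (inc e w * inc e w))
            ≡⟨ ∑-+ edges (λ e → count es e * (inc e w * inc e w)) (λ e → m e * (inc e w * inc e w)) ⟩
          (∑[ e ← edges ] (count es e * (inc e w * inc e w))) + extra w
            ≡⟨ cong (_+ extra w) (trans (∑-count es (λ e → inc e w * inc e w))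
                 (trans (tree-degree T w) (addˡ (τ w) (count-∈ (unique-vertices T) (all∈ w))))) ⟩
          τ w + 1ℤ + extra w ∎
          where
          open ≡-Reasoning
          rearrange : ∀ c i → i ≡ c * i + (1ℤ - c) * i
          rearrange = solve-∀

        -- The degree is τ + 1 inside the tree plus an `extra` of the parity of τ.
        deg-odd : ∀ w → + 2 ∣ deg w - 1ℤ
        deg-odd w = subst (+ 2 ∣_) (sym eq) (∣m∣n⇒∣m+n (∑-∣ edges λ {e} _ → even-part-even w e) (divides (τ w) refl))
          where
          rearrange : ∀ t s → t + 1ℤ + (s + t) - 1ℤ ≡ s + t * + 2
          rearrange = solve-∀
          eq : deg w - 1ℤ ≡ ∑ edges (even-part w) + τ w * + 2
          eq = trans (cong (_- 1ℤ) (trans (deg-split w) (addˡ (τ w + 1ℤ) (extra-parity w))))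
                   (rearrange (τ w) (∑ edges (even-part w)))

        0≤m : ∀ e → 0ℤ ≤ m e
        0≤m e with e ∈? es
        ... | yes e∈es = ℤ.≤-reflexive (sym (mask-∈ (unique-edges T) e∈es))
        ... | no  e∉es = subst (0ℤ ≤_) (sym (mask-∉ e∉es)) (+≤+ ℕ.z≤n)

        2≤deg : ∀ w → + 2 ≤ deg w
        2≤deg w = subst (+ 2 ≤_) (sym (deg-split w))
          (ℤ.+-mono-≤ (ℤ.+-mono-≤ (covered (all∈ w)) (ℤ.≤-refl {1ℤ})) (0≤∑ edges λ {e} _ →
            ℤ.≤-trans (ℤ.≤-reflexive (sym (ℤ.*-zeroʳ (m e))))
              (ℤ.*-monoˡ-≤-nonNeg (m e) {{nonNegative (0≤m e)}} (0≤square (inc e w)))))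

        -- Since the coefficients are 0 or ±1, this is the number of triangles that the edge uses.
        weight : Edge → ℤ
        weight e = ∑[ tg ← basis T ] (q (proj₂ tg) e * q (proj₂ tg) e)

        0≤weight : ∀ e → 0ℤ ≤ weight e
        0≤weight e = 0≤∑ (basis T) λ {tg} _ → 0≤square (q (proj₂ tg) e)

        -- Summing `m-inc` over all vertices gives 0 on the left, and each triangle counts 3 on the
        -- right.
        ∑-q≡0 : ∀ e → ∑[ tg ← basis T ] q (proj₂ tg) e ≡ 0ℤ
        ∑-q≡0 e = ℤ.*-cancelˡ-≡ (+ 3) _ 0ℤ (begin
          + 3 * (∑[ tg ← basis T ] q (proj₂ tg) e)
            ≡⟨ ∑-* (basis T) (+ 3) (λ tg → q (proj₂ tg) e) ⟨
          ∑[ tg ← basis T ] (+ 3 * q (proj₂ tg) e)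
            ≡⟨ ∑-cong (basis T) (λ {tg} tg∈ → begin
                 + 3 * q (proj₂ tg) e                  ≡⟨ ℤ.*-comm (+ 3) (q (proj₂ tg) e) ⟩
                 q (proj₂ tg) e * + 3                  ≡⟨ cong (q (proj₂ tg) e *_) (All.lookup (basis-sums T) tg∈) ⟨
                 q (proj₂ tg) e * ∑ vertices (proj₁ tg) ≡⟨ ∑-* vertices (q (proj₂ tg) e) (proj₁ tg) ⟨
                 ∑[ w ← vertices ] (q (proj₂ tg) e * proj₁ tg w)
                   ≡⟨ ∑-≗ vertices (λ w → ℤ.*-comm (q (proj₂ tg) e) (proj₁ tg w)) ⟩
                 ∑[ w ← vertices ] (proj₁ tg w * q (proj₂ tg) e) ∎) ⟩
          ∑[ tg ← basis T ] ∑[ w ← vertices ] (proj₁ tg w * q (proj₂ tg) e)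
            ≡⟨ ∑-swap (basis T) vertices (λ tg w → proj₁ tg w * q (proj₂ tg) e) ⟩
          ∑[ w ← vertices ] ∑[ tg ← basis T ] (proj₁ tg w * q (proj₂ tg) e)
            ≡⟨ ∑-≗ vertices (λ w → trans (sym (m-inc e w)) (ℤ.*-comm (m e) (inc e w))) ⟩
          ∑[ w ← vertices ] (inc e w * m e)
            ≡⟨ ⟨⟩-comm (inc e) (λ _ → m e) ⟩
          ⟨ (λ _ → m e) , inc e ⟩
            ≡⟨ ⟨⟩-inc (λ _ → m e) e ⟩
          m e - m e
            ≡⟨ ℤ.+-inverseʳ (m e) ⟩
          0ℤ ∎)
          where open ≡-Reasoning

        -- The squares of the coefficients have the same parity as the coefficients, whose sum is 0.
        weight-even : ∀ e → + 2 ∣ weight e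
        weight-even e = subst (+ 2 ∣_) eq (∑-∣ (basis T) λ {tg} tg∈ → trit-even (q-trit tg∈ e))
          where
          eq : ∑[ tg ← basis T ] (q (proj₂ tg) e * q (proj₂ tg) e - q (proj₂ tg) e) ≡ weight e
          eq = begin
            ∑[ tg ← basis T ] (q (proj₂ tg) e * q (proj₂ tg) e - q (proj₂ tg) e)
              ≡⟨ ∑-≗ (basis T) (λ tg → addˡ (q (proj₂ tg) e * q (proj₂ tg) e) (sym (ℤ.-1*i≡-i (q (proj₂ tg) e)))) ⟩
            ∑[ tg ← basis T ] (q (proj₂ tg) e * q (proj₂ tg) e + -1ℤ * q (proj₂ tg) e)
              ≡⟨ ∑-+ (basis T) (λ tg → q (proj₂ tg) e * q (proj₂ tg) e) (λ tg → -1ℤ * q (proj₂ tg) e) ⟩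
            weight e + (∑[ tg ← basis T ] (-1ℤ * q (proj₂ tg) e))
              ≡⟨ addˡ (weight e) (trans (∑-* (basis T) -1ℤ (λ tg → q (proj₂ tg) e)) (cong (-1ℤ *_) (∑-q≡0 e))) ⟩
            weight e + 0ℤ
              ≡⟨ ℤ.+-identityʳ (weight e) ⟩
            weight e ∎
            where open ≡-Reasoning

        square≤0 : ∀ {x} → Trit x → x * x ≤ 0ℤ → x ≡ 0ℤ
        square≤0 t0 _ = refl
        square≤0 t+ (+≤+ ())
        square≤0 t- (+≤+ ())

        -- With all coefficients 0, the expansion could not produce the entry 1 at the tail of `e`.
        weight≢0 : ∀ e → e ∉ es → weight e ≢ 0ℤ
        weight≢0 e e∉es w≡0 = contra (trans (sym at-tail) (trans (m-inc e (tail e))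
            (trans (∑-cong (basis T) λ {tg} tg∈ → trans (cong (proj₁ tg (tail e) *_) (zero-q tg∈))
                                                           (ℤ.*-zeroʳ (proj₁ tg (tail e))))
                   (∑-zero (basis T)))))
          where
          contra : 1ℤ ≢ 0ℤ
          contra ()
          at-tail : m e * inc e (tail e) ≡ 1ℤ
          at-tail = trans (cong (_* inc e (tail e)) (mask-∉ e∉es))
            (trans (ℤ.*-identityˡ (inc e (tail e))) (cong₂ _-_ (δ-refl (tail e)) (δ-≢ (loopless e ∘ sym))))
          zero-q : ∀ {tg} → tg ∈ basis T → q (proj₂ tg) e ≡ 0ℤ
          zero-q {tg} tg∈ = square≤0 (q-trit tg∈ e)
            (ℤ.≤-trans (term≤∑ {f = λ tg → q (proj₂ tg) e * q (proj₂ tg) e} (λ tg → 0≤square (q (proj₂ tg) e)) tg∈)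
                       (ℤ.≤-reflexive w≡0))

        2m≤weight : ∀ e → m e * + 2 ≤ weight e
        2m≤weight e with e ∈? es
        ... | yes e∈es = subst (_≤ weight e) (sym (cong (_* + 2) (mask-∈ (unique-edges T) e∈es))) (0≤weight e)
        ... | no  e∉es = subst (_≤ weight e) (sym (cong (_* + 2) (mask-∉ e∉es)))
                           (even-positive (0≤weight e) (weight-even e) (weight≢0 e e∉es))

        ∑-const : ∀ {A : Set} (xs : List A) c → ∑[ x ← xs ] c ≡ c * + length xs
        ∑-const xs c = trans (∑-≗ xs λ _ → sym (ℤ.*-identityʳ c)) (trans (∑-* xs c (λ _ → 1ℤ)) (cong (c *_) (∑-1 xs)))

        ∑-τ : ∑ vertices τ ≡ + 3 * k
        ∑-τ = trans (∑-swap vertices (basis T) (λ w tg → proj₁ tg w))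
          (trans (∑-cong (basis T) (All.lookup (basis-sums T))) (∑-const (basis T) (+ 3)))

        order≡ : + length vertices ≡ + 2 + k
        order≡ = begin
          + length vertices                         ≡⟨ ∑-1 vertices ⟨
          ∑[ w ← vertices ] 1ℤ                      ≡⟨ ∑-≗ vertices (λ w → trans (sym (count-∈ (unique-vertices T) (all∈ w)))
                                                                                       (sym (ℤ.*-identityʳ (count vs w)))) ⟩
          ∑[ w ← vertices ] (count vs w * 1ℤ)       ≡⟨ ∑-count vs (λ _ → 1ℤ) ⟩
          ∑[ w ← vs ] 1ℤ                            ≡⟨ ∑-1 vs ⟩
          + length vs                               ≡⟨ cong +_ (vertex-count T) ⟩
          + 2 + k                                   ∎
          where open ≡-Reasoning

        -- Each edge outside the tree counts 2 on the left and is paid for by the at least two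
        -- triangles it uses; each triangle is used by one edge only.
        ∑-extra : ∑ vertices extra ≤ k
        ∑-extra = subst₂ _≤_ (sym total) total′ (∑-≤ edges λ {e} _ → 2m≤weight e)
          where
          open ≡-Reasoning
          total : ∑ vertices extra ≡ ∑[ e ← edges ] (m e * + 2)
          total = begin
            ∑[ w ← vertices ] ∑[ e ← edges ] (m e * (inc e w * inc e w))
              ≡⟨ ∑-swap vertices edges (λ w e → m e * (inc e w * inc e w)) ⟩
            ∑[ e ← edges ] ∑[ w ← vertices ] (m e * (inc e w * inc e w))
              ≡⟨ ∑-≗ edges (λ e → trans (∑-* vertices (m e) (λ w → inc e w * inc e w)) (cong (m e *_)
                   (trans (∑-≗ vertices (inc² {e} (inj₁ refl))) (trans (∑-+ vertices (δ (tail e)) (δ (head e)))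
                     (cong₂ _+_ (∑-δ1 (tail e)) (∑-δ1 (head e))))))) ⟩
            ∑[ e ← edges ] (m e * + 2) ∎
          total′ : ∑ edges weight ≡ k
          total′ = begin
            ∑[ e ← edges ] ∑[ tg ← basis T ] (q (proj₂ tg) e * q (proj₂ tg) e)
              ≡⟨ ∑-swap edges (basis T) (λ e tg → q (proj₂ tg) e * q (proj₂ tg) e) ⟩
            ∑[ tg ← basis T ] ∑[ e ← edges ] (q (proj₂ tg) e * q (proj₂ tg) e)
              ≡⟨ trans (∑-cong (basis T) (All.lookup ones)) (∑-1 (basis T)) ⟩
            k ∎

        ∑-deg : ∑ vertices deg ≤ + 3 * k + (+ 2 + k) + k
        ∑-deg = subst (_≤ + 3 * k + (+ 2 + k) + k) (sym eq) (ℤ.+-monoʳ-≤ (+ 3 * k + (+ 2 + k)) ∑-extra)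
          where
          eq : ∑ vertices deg ≡ + 3 * k + (+ 2 + k) + ∑ vertices extra
          eq = trans (∑-≗ vertices deg-split) (trans (∑-+ vertices (λ w → τ w + 1ℤ) extra)
            (cong (_+ ∑ vertices extra) (trans (∑-+ vertices τ (λ _ → 1ℤ))
                                         (cong₂ _+_ ∑-τ (trans (∑-1 vertices) order≡)))))

        degree≡deg : ∀ w → + degree w ≡ deg w
        degree≡deg w = trans (sym (∑-1 (filter (incident? w) edges)))
          (∑-filter (incident? w) (λ _ → 1ℤ) incident not-incident edges)
          where
          sq : ∀ e → inc e w * inc e w ≡ δ (tail e) w + δ (head e) w
          sq e = inc² {e} (inj₁ refl) w
          incident : ∀ {e} → Incident w e → inc e w * inc e w ≡ 1ℤ
          incident {e} (inj₁ refl) = trans (sq e) (cong₂ _+_ (δ-refl (tail e)) (δ-≢ (loopless e ∘ sym)))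
          incident {e} (inj₂ refl) = trans (sq e) (cong₂ _+_ (δ-≢ (loopless e)) (δ-refl (head e)))
          not-incident : ∀ {e} → ¬ Incident w e → inc e w * inc e w ≡ 0ℤ
          not-incident {e} ¬inc = trans (sq e) (cong₂ _+_ (δ-≢ (¬inc ∘ inj₁)) (δ-≢ (¬inc ∘ inj₂)))

        cubic : Vertex → ℤ
        cubic w with degree w ℕ.≟ 3
        ... | yes _ = 1ℤ
        ... | no  _ = 0ℤ

        -- A credit of 2 lifts degree 3 to 5; all other degrees are odd and at least 5 already.
        5≤deg : ∀ w → + 5 ≤ deg w + + 2 * cubic w
        5≤deg w with degree w ℕ.≟ 3
        ... | yes d≡3 = ℤ.≤-reflexive (cong (_+ + 2) (trans (cong +_ (sym d≡3)) (degree≡deg w)))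
        ... | no  d≢3 = subst (+ 5 ≤_) (trans (degree≡deg w) (sym (ℤ.+-identityʳ (deg w))))
                          (odd≥5 (degree w) (subst (+ 2 ≤_) (sym (degree≡deg w)) (2≤deg w))
                            (subst (λ d → + 2 ∣ d - 1ℤ) (sym (degree≡deg w)) (deg-odd w)) d≢3)

        ∑-cubic : ∑ vertices cubic ≡ + length (verticesOfDegree 3)
        ∑-cubic = trans (sym (∑-filter (λ v → degree v ℕ.≟ 3) (λ _ → 1ℤ) is isn't vertices)) (∑-1 (verticesOfDegree 3))
          where
          is : ∀ {w} → degree w ≡ 3 → cubic w ≡ 1ℤ
          is {w} d≡3 with degree w ℕ.≟ 3
          ... | yes _ = refl
          ... | no  p = ⊥-elim (p d≡3)
          isn't : ∀ {w} → degree w ≢ 3 → cubic w ≡ 0ℤ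
          isn't {w} d≢3 with degree w ℕ.≟ 3
          ... | yes p = ⊥-elim (d≢3 p)
          ... | no  _ = refl

        many-cubic : ¬ length (verticesOfDegree 3) ℕ.≤ 3
        many-cubic few = ℤ.<⇒≱ too-big bound
          where
          -- The 6 is the credit of three cubic vertices. The two sides come to 5k + 10 and 5k + 8,
          -- so three credits fall short.
          bound : + 5 * (+ 2 + k) ≤ + 3 * k + (+ 2 + k) + k + + 6
          bound = begin
            + 5 * (+ 2 + k)                              ≡⟨ trans (∑-const vertices (+ 5)) (cong (+ 5 *_) order≡) ⟨
            ∑[ w ← vertices ] + 5                        ≤⟨ ∑-≤ vertices (λ {w} _ → 5≤deg w) ⟩
            ∑[ w ← vertices ] (deg w + + 2 * cubic w)    ≡⟨ trans (∑-+ vertices deg (λ w → + 2 * cubic w))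
                                                              (addˡ (∑ vertices deg) (trans (∑-* vertices (+ 2) cubic)
                                                                                          (cong (+ 2 *_) ∑-cubic))) ⟩
            ∑ vertices deg + + 2 * + length (verticesOfDegree 3)
              ≤⟨ ℤ.+-mono-≤ ∑-deg (ℤ.*-monoˡ-≤-nonNeg (+ 2) (+≤+ few)) ⟩
            + 3 * k + (+ 2 + k) + k + + 6 ∎
            where open ℤ.≤-Reasoning
          collect₁ : ∀ k → + 3 * k + (+ 2 + k) + k + + 6 ≡ + 5 * k + + 8
          collect₁ = solve-∀
          collect₂ : ∀ k → + 5 * (+ 2 + k) ≡ + 5 * k + + 10
          collect₂ = solve-∀
          too-big : + 3 * k + (+ 2 + k) + k + + 6 < + 5 * (+ 2 + k)
          too-big = subst₂ _<_ (sym (collect₁ k)) (sym (collect₂ k)) (ℤ.+-monoʳ-< (+ 5 * k) (+<+ (ℕ.s≤s (ℕ.m≤n+m 8 1))))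

    flow : length (verticesOfDegree 3) ℕ.≤ 3 → NowhereZero3Flow G
    flow few with any? (λ e → ¬? (e ∈? es) ×-dec ¬? (χ T (tail e) ℤ.≟ χ T (head e)))
    ... | yes (e , e∉es , ¬mono) = dichromatic⇒flow e e∉es ¬mono
    ... | no none = case either-all (basis T) (flow-or-one mono) of λ
        { (inj₁ found) → found
        ; (inj₂ ones)  → ⊥-elim (many-cubic mono ones few) }
      where
      mono : ∀ e → e ∉ es → Monochromatic e
      mono e e∉es = decidable-stable (χ T (tail e) ℤ.≟ χ T (head e)) λ ¬mono → none (e , e∉es , ¬mono)

corollary1p7 : (G : Graph) → HasSpanningTriangleTree G → length (Graph.verticesOfDegree G 3) ℕ.≤ 3 → NowhereZero3Flow G
corollary1p7 G (V , E , tree , spanning) = Spanned.flow T covered (λ v → V⇒vs (spanning v))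
  where
  open OnGraph G
  open Presentation (present tree) renaming (tree to T)
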